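{- For every integer $r\ge 0$, the functions $F_r(x,y)$ and $F_r(x)$ satisfy the functional equations $$(i)\quad F_r(x,y)=x^{ -r(r+1)/2}\,y^{ -2}\,F_r\!\left(\frac1x,\frac1y\right),$$ $$(ii)\quad F_r(x)=x^{ -r(r+3)/2}\,F_r\!\left(\frac1x\right).$$
   Context: For integers $r,k,j\ge 0$ let $$\alpha_r(k,j)=\sum_{\substack{c_1+\cdots+c_r=k\\ 0\le c_1\le\cdots\le c_r}}\ \sum_{d_0=-j}^{0}\ \sum_{d_1=d_0}^{c_1}\ \sum_{d_2=d_1}^{c_2}\cdots\sum_{d_r=d_{r-1}}^{c_r}1,$$ with all $c_i,d_i$ integers (for $r=0$ the outer sum is empty unless $k=0$, in which case $\alpha_0(0,j)=j+1$). Let $\alpha_r(k)$ be the number of pairs of integer sequences $0\le c_1\le\cdots\le c_r$, $0\le d_1\le\cdots\le d_r$ with $c_1+\cdots+c_r=k$ and $d_i\le c_i$ for all $i$. The generating functions are $$F_r(x)=\sum_{k=0}^\infty\alpha_r(k)x^k,\qquad F_r(x,y)=\sum_{k,j=0}^\infty\alpha_r(k,j)x^ky^j.$$ These power series are expansions of rational functions, denoted by the same symbols; $F_r(1/x)$ and $F_r(1/x,1/y)$ are obtained by substitution in these rational functions, and the functional equations are identities of rational functions. -}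

module Defs where

open import Data.Integer as ℤ using (ℤ; +_; -[1+_]; 0ℤ; 1ℤ; ∣_∣)
import Data.Integer.Properties as ℤ
open import Data.List using (List; []; _∷_; map; filter; upTo; length; cartesianProduct; cartesianProductWith)
open import Data.Nat.ListAction using (sum)
open import Data.Nat as ℕ using (ℕ; zero; suc)
import Data.Nat.Properties as ℕ
open import Data.Product using (_×_; _,_)
open import Data.Vec as Vec using (Vec; []; _∷_)
import Data.Vec.Properties as Vec
open import Data.Vec.Relation.Binary.Pointwise.Inductive as Pointwise using (Pointwise)
open import Data.Vec.Relation.Unary.Linked using (Linked; linked?)
open import Relation.Binary.Definitions using (DecidableEquality)
open import Relation.Binary.PropositionalEquality using (_≡_; refl; sym; trans; cong; cong₂)
open import Relation.Nullary using (¬_; yes; no; contradiction)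
open import Relation.Nullary.Decidable using (_×-dec_)
open import Relation.Unary using (Decidable)

-- The integers d with a ≤ d ≤ b, in increasing order; none if b < a.
[_⋯_] : ℤ → ℤ → List ℤ
[ a ⋯ b ] = map (λ i → a ℤ.+ + i) (upTo ∣ 0ℤ ℤ.⊔ (b ℤ.- a ℤ.+ 1ℤ) ∣)

Ascending : ∀ {r} → Vec ℕ r → Set
Ascending = Linked ℕ._≤_

ascending? : ∀ {r} → Decidable (Ascending {r})
ascending? = linked? ℕ._≤?_

-- The r-tuples of naturals with all entries at most b.
tuples : (r b : ℕ) → List (Vec ℕ r)
tuples zero    b = [] ∷ []
tuples (suc r) b = cartesianProductWith _∷_ (upTo (suc b)) (tuples r b)

-- The bound k loses nothing: entries of a tuple of naturals summing to k
-- are at most k.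
ascendingWithSum : (r k : ℕ) → List (Vec ℕ r)
ascendingWithSum r k =
  filter (λ c → (Vec.sum c ℕ.≟ k) ×-dec ascending? c) (tuples r k)

-- nested d (c₁ ∷ … ∷ cᵣ ∷ []) is ∑_{d₁=d}^{c₁} ∑_{d₂=d₁}^{c₂} ⋯ ∑_{dᵣ=dᵣ₋₁}^{cᵣ} 1.
nested : ∀ {r} → ℤ → Vec ℕ r → ℕ
nested d []       = 1
nested d (c ∷ cs) = sum (map (λ d′ → nested d′ cs) [ d ⋯ + c ])

-- α_r(k,j), where nested d₀ c accounts for the sums over d₁, …, dᵣ.
α₂ : (r k j : ℕ) → ℕ
α₂ r k j =
  sum (map (λ c → sum (map (λ d₀ → nested d₀ c) [ ℤ.- (+ j) ⋯ 0ℤ ]))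
           (ascendingWithSum r k))

-- (c , d) is one of the pairs of sequences counted by α_r(k).
IsPair : ∀ {r} → ℕ → Vec ℕ r × Vec ℕ r → Set
IsPair k (c , d) =
  Ascending c × Ascending d × (Vec.sum c ≡ k) × Pointwise ℕ._≤_ d c

isPair? : ∀ {r} k → Decidable (IsPair {r} k)
isPair? k (c , d) =
  ascending? c ×-dec ascending? d ×-dec (Vec.sum c ℕ.≟ k)
    ×-dec Pointwise.decidable ℕ._≤?_ d c

-- α_r(k); again every entry of a counted pair is at most k.
α₁ : (r k : ℕ) → ℕ
α₁ r k = length (filter (isPair? k) (cartesianProduct (tuples r k) (tuples r k)))

PowerSeries : ℕ → Set
PowerSeries n = Vec ℕ n → ℤ

F₁ : ℕ → PowerSeries 1
F₁ r (k ∷ []) = + α₁ r k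

F₂ : ℕ → PowerSeries 2
F₂ r (k ∷ j ∷ []) = + α₂ r k j

-- The coefficient at any integer exponent, zero if some entry is negative.
coeffˢ : ∀ {n} → PowerSeries n → Vec ℤ n → ℤ
coeffˢ F []             = F []
coeffˢ F (+ k ∷ e)      = coeffˢ (λ e′ → F (k ∷ e′)) e
coeffˢ F (-[1+ _ ] ∷ e) = 0ℤ

Exponent : ℕ → Set
Exponent n = Vec ℤ n

infixl 6 _+ᵉ_
infix  8 -ᵉ_

_+ᵉ_ : ∀ {n} → Exponent n → Exponent n → Exponent n
_+ᵉ_ = Vec.zipWith ℤ._+_

-ᵉ_ : ∀ {n} → Exponent n → Exponent n
-ᵉ_ = Vec.map (λ i → ℤ.- i)

_≟ᵉ_ : ∀ {n} → DecidableEquality (Exponent n)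
_≟ᵉ_ = Vec.≡-dec ℤ._≟_

Term : ℕ → Set
Term n = ℤ × Exponent n

-- A Laurent polynomial over ℤ in n variables is a list of terms
-- (coefficient , exponent), read as their sum.  Exponents may repeat and
-- coefficients may vanish, so equality is _≋_ below, not _≡_.
Laurent : ℕ → Set
Laurent n = List (Term n)

coeff : ∀ {n} → Laurent n → Exponent n → ℤ
coeff []            e = 0ℤ
coeff ((c , a) ∷ p) e with a ≟ᵉ e
... | yes _ = c ℤ.+ coeff p e
... | no  _ = coeff p e

infix 4 _≋_

_≋_ : ∀ {n} → Laurent n → Laurent n → Set
p ≋ q = ∀ e → coeff p e ≡ coeff q e

infixl 7 _·ᵗ_ _·_

_·ᵗ_ : ∀ {n} → Term n → Term n → Term n
(c , a) ·ᵗ (d , b) = c ℤ.* d , a +ᵉ b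

_·_ : ∀ {n} → Laurent n → Laurent n → Laurent n
_·_ = cartesianProductWith _·ᵗ_

monomial : ∀ {n} → Exponent n → Laurent n
monomial e = (1ℤ , e) ∷ []

invertTerm : ∀ {n} → Term n → Term n
invertTerm (c , a) = c , -ᵉ a

-- p(1/x₁,…,1/xₙ)
invertVars : ∀ {n} → Laurent n → Laurent n
invertVars = map invertTerm

-- The coefficient at e of the product of a Laurent polynomial and a power series.
coeffOfProduct : ∀ {n} → Laurent n → PowerSeries n → Exponent n → ℤ
coeffOfProduct []            F e = 0ℤ
coeffOfProduct ((c , a) ∷ p) F e = c ℤ.* coeffˢ F (e +ᵉ -ᵉ a) ℤ.+ coeffOfProduct p F e

-ᵉ-involutive : ∀ {n} (e : Exponent n) → -ᵉ (-ᵉ e) ≡ e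
-ᵉ-involutive []      = refl
-ᵉ-involutive (i ∷ e) = cong₂ _∷_ (ℤ.neg-involutive i) (-ᵉ-involutive e)

coeff-invertVars : ∀ {n} (p : Laurent n) e → coeff (invertVars p) (-ᵉ e) ≡ coeff p e
coeff-invertVars []            e = refl
coeff-invertVars ((c , a) ∷ p) e with (-ᵉ a) ≟ᵉ (-ᵉ e) | a ≟ᵉ e
... | yes _   | yes _   = cong (λ i → c ℤ.+ i) (coeff-invertVars p e)
... | no  _   | no  _   = coeff-invertVars p e
... | yes -a≡-e | no a≢e = contradiction
  (trans (sym (-ᵉ-involutive a)) (trans (cong -ᵉ_ -a≡-e) (-ᵉ-involutive e))) a≢e
... | no -a≢-e | yes a≡e = contradiction (cong -ᵉ_ a≡e) -a≢-e

-- Polynomials and Laurent polynomials over ℤ have the same field of fractions,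
-- ℚ(x₁,…,xₙ); with the latter, inverting the variables acts on numerators and
-- denominators separately.
record RationalFunction (n : ℕ) : Set where
  field
    num   : Laurent n
    den   : Laurent n
    den≉0 : ¬ (den ≋ [])

open RationalFunction public

infix 4 _≈_

_≈_ : ∀ {n} → RationalFunction n → RationalFunction n → Set
f ≈ g = num f · den g ≋ num g · den f

-- f(1/x₁,…,1/xₙ)
_⟨1/x⟩ : ∀ {n} → RationalFunction n → RationalFunction n
f ⟨1/x⟩ = record
  { num   = invertVars (num f)
  ; den   = invertVars (den f)
  ; den≉0 = λ inv≋0 → den≉0 f λ e →
      trans (sym (coeff-invertVars (den f) e)) (inv≋0 (-ᵉ e))
  }

infixr 7 x^_*_

-- x^ e * f is x₁^e₁ ⋯ xₙ^eₙ f.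
x^_*_ : ∀ {n} → Exponent n → RationalFunction n → RationalFunction n
x^ e * f = record
  { num   = monomial e · num f
  ; den   = den f
  ; den≉0 = den≉0 f
  }

infix 4 _IsExpansionOf_

_IsExpansionOf_ : ∀ {n} → PowerSeries n → RationalFunction n → Set
F IsExpansionOf f = ∀ e → coeffOfProduct (den f) F e ≡ coeff (num f) e

{-# OPTIONS --safe #-}

-- Let A r t n k count the pairs of an ascending c with c₁ + ⋯ + cᵣ = k and a
-- sequence -n = d_{t-1} ≤ d_t ≤ ⋯ ≤ dᵣ with dᵢ ≤ cᵢ, where c₀ = 0, so that
-- α_r(k) = A r 1 0 k and α_r(k,j) = A r 0 j k.  Lowering d_{t-1} by one, and
-- subtracting one from every cᵢ unless c₁ = 0, gives two recurrences for A, by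
-- which A extends to all integers n.  They are self-dual: the family
--   (-1)^(t+1) A r t (t-2-n) (-k - r(r+1)/2)
-- satisfies them too.  By induction on r and downwards on t, the recurrences
-- determine a family up to functions of k killed by a product of factors 1 - x^w.
-- So the series and its reflection are expansions, in opposite directions, of one
-- rational function, which is the functional equation.

module Submission where

open import Defs
open import Algebra.Properties.AbelianGroup using (∙-cancelʳ)
open import Data.Fin using (zero; suc)
open import Data.Integer as ℤ using (ℤ; +_; -[1+_]; 0ℤ; 1ℤ; -1ℤ; -_)
import Data.Integer.Properties as ℤ
open import Data.Integer.Tactic.RingSolver using (solve-∀)
open import Data.List
  using (List; []; _∷_; _++_; map; foldr; replicate; filter; upTo; length; cartesianProductWith)
import Data.List.Properties as List
open import Data.List.Membership.Propositional using (_∈_)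
import Data.List.Membership.Propositional.Properties as ∈
open import Data.List.Membership.Propositional.Properties.WithK using (unique∧set⇒bag)
open import Data.List.Relation.Binary.BagAndSetEquality using (∼bag⇒↭)
open import Data.List.Relation.Binary.Permutation.Propositional using (_↭_)
import Data.List.Relation.Binary.Permutation.Propositional.Properties as ↭
open import Data.List.Relation.Unary.All as All using (All; []; _∷_)
import Data.List.Relation.Unary.All.Properties as All
open import Data.List.Relation.Unary.AllPairs using ([]; _∷_)
open import Data.List.Relation.Unary.Any using (here)
open import Data.List.Relation.Unary.Unique.Propositional using (Unique)
import Data.List.Relation.Unary.Unique.Propositional.Properties as Unique
open import Data.Nat as ℕ using (ℕ; zero; suc; _+_; _*_; _∸_; _/_)
open import Data.Nat.DivMod using (m*n/n≡m)
open import Data.Nat.ListAction using (sum)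
open import Data.Nat.ListAction.Properties using (sum-↭; sum-++)
import Data.Nat.Properties as ℕ
import Data.Nat.Tactic.RingSolver as ℕ-Solver
open import Data.Product using (_×_; _,_; proj₁; proj₂; ∃-syntax)
open import Data.Sum using (_⊎_; inj₁; inj₂; [_,_]′)
open import Data.Vec as Vec using (Vec; []; _∷_; lookup)
import Data.Vec.Properties as Vec
open import Data.Vec.Relation.Binary.Pointwise.Inductive as Pointwise using (Pointwise; []; _∷_)
open import Data.Vec.Relation.Unary.All as Allⱽ using ([]; _∷_) renaming (All to Allⱽ)
open import Data.Vec.Relation.Unary.Linked as Linked using ([]; [-]; _∷_)
import Data.Vec.Relation.Unary.Linked.Properties as Linked
open import Function using (_∘_; mk⇔)
open import Level using (0ℓ)
open import Relation.Binary.PropositionalEquality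
open import Relation.Nullary using (yes; no; contradiction; ¬_)
open import Relation.Nullary.Decidable using (_×-dec_)
open import Relation.Unary using (Pred; Decidable)

-- In general a series and its reflection are different functions of the exponent: one vanishes at
-- small exponents, the other at large ones. A product of factors 1 - x^a makes them equal and hence
-- finitely supported, so that reciprocity yields rationality as well as the functional equation.
--
-- The index t is what makes the recurrences close. The recurrence that lowers k also moves n;
-- eliminating that move raises t, and past t = r + 1 nothing is left.
--
-- The constants are forced by the duality. From length r to r + 1 its shift of k grows by r + 1,
-- the amount that leaves k when every cᵢ drops by one; this adds up to r(r+1)/2. For α_r(k,j),
-- where t = 0, n goes to -2 - n, whence y^(-2). For α_r(k), where t = 1, n = 0 goes to n = -1, and
-- returning to n = 0 shifts k by a further r, whence r(r+3)/2. This is also why A is wanted at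
-- negative n.

infixl 6 _⊖_

_⊖_ : ∀ {n} → Exponent n → Exponent n → Exponent n
e ⊖ a = e +ᵉ -ᵉ a

0ᵉ : ∀ {n} → Exponent n
0ᵉ = Vec.replicate _ 0ℤ

⁺_ : ∀ {n} → Vec ℕ n → Exponent n
⁺_ = Vec.map (λ k → + k)

⊖-identityʳ : ∀ {n} (e : Exponent n) → e ⊖ 0ᵉ ≡ e
⊖-identityʳ []      = refl
⊖-identityʳ (i ∷ e) = cong₂ _∷_ (ℤ.+-identityʳ i) (⊖-identityʳ e)

⊖-self : ∀ {n} (e : Exponent n) → e ⊖ e ≡ 0ᵉ
⊖-self []      = refl
⊖-self (i ∷ e) = cong₂ _∷_ (ℤ.+-inverseʳ i) (⊖-self e)

⊖-comm : ∀ {n} (e a b : Exponent n) → e ⊖ a ⊖ b ≡ e ⊖ b ⊖ a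
⊖-comm []      []      []      = refl
⊖-comm (i ∷ e) (j ∷ a) (k ∷ b) = cong₂ _∷_ (swap i j k) (⊖-comm e a b)
  where
  swap : ∀ i j k → i ℤ.+ - j ℤ.+ - k ≡ i ℤ.+ - k ℤ.+ - j
  swap = solve-∀

⊖-+ᵉ : ∀ {n} (e a b : Exponent n) → e ⊖ (a +ᵉ b) ≡ e ⊖ a ⊖ b
⊖-+ᵉ []      []      []      = refl
⊖-+ᵉ (i ∷ e) (j ∷ a) (k ∷ b) = cong₂ _∷_ (assoc i j k) (⊖-+ᵉ e a b)
  where
  assoc : ∀ i j k → i ℤ.+ - (j ℤ.+ k) ≡ i ℤ.+ - j ℤ.+ - k
  assoc = solve-∀

⊖≡0⇒≡ : ∀ {n} (e a : Exponent n) → 0ᵉ ≡ e ⊖ a → a ≡ e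
⊖≡0⇒≡ []      []      _  = refl
⊖≡0⇒≡ (i ∷ e) (j ∷ a) eq =
  cong₂ _∷_ (sym (ℤ.i-j≡0⇒i≡j i j (sym (Vec.∷-injectiveˡ eq)))) (⊖≡0⇒≡ e a (Vec.∷-injectiveʳ eq))

lookup-⊖ : ∀ {n} (e a : Exponent n) i → lookup (e ⊖ a) i ≡ lookup e i ℤ.- lookup a i
lookup-⊖ e a i = trans (Vec.lookup-zipWith ℤ._+_ i e (-ᵉ a))
  (cong (λ j → lookup e i ℤ.+ j) (Vec.lookup-map i (λ j → - j) a))

lookup-⊖⁺ : ∀ {n} (e : Exponent n) (a : Vec ℕ n) i →
  lookup (e ⊖ ⁺ a) i ≡ lookup e i ℤ.- + lookup a i
lookup-⊖⁺ e a i = trans (lookup-⊖ e (⁺ a) i) (cong (λ j → lookup e i ℤ.- j) (Vec.lookup-map i (λ k → + k) a))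

-- Laurent polynomials acting on functions of the exponent

act : ∀ {n} → Laurent n → (Exponent n → ℤ) → Exponent n → ℤ
act []            φ e = 0ℤ
act ((c , a) ∷ p) φ e = c ℤ.* φ (e ⊖ a) ℤ.+ act p φ e

act-cong : ∀ {n} (p : Laurent n) {φ ψ} → φ ≗ ψ → act p φ ≗ act p ψ
act-cong []            φ≗ψ e = refl
act-cong ((c , a) ∷ p) φ≗ψ e = cong₂ (λ i j → c ℤ.* i ℤ.+ j) (φ≗ψ (e ⊖ a)) (act-cong p φ≗ψ e)

act-++ : ∀ {n} (p q : Laurent n) φ e → act (p ++ q) φ e ≡ act p φ e ℤ.+ act q φ e
act-++ []            q φ e = sym (ℤ.+-identityˡ _)
act-++ ((c , a) ∷ p) q φ e =
  trans (cong (λ i → c ℤ.* φ (e ⊖ a) ℤ.+ i) (act-++ p q φ e)) (sym (ℤ.+-assoc (c ℤ.* φ (e ⊖ a)) _ _))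

act-·ᵗ : ∀ {n} (c : ℤ) (a : Exponent n) q φ e →
  act (map ((c , a) ·ᵗ_) q) φ e ≡ c ℤ.* act q φ (e ⊖ a)
act-·ᵗ c a []            φ e = sym (ℤ.*-zeroʳ c)
act-·ᵗ c a ((d , b) ∷ q) φ e = trans
  (cong₂ (λ i j → (c ℤ.* d) ℤ.* φ i ℤ.+ j) (⊖-+ᵉ e a b) (act-·ᵗ c a q φ e))
  (factor c d _ _)
  where
  factor : ∀ c d x y → (c ℤ.* d) ℤ.* x ℤ.+ c ℤ.* y ≡ c ℤ.* (d ℤ.* x ℤ.+ y)
  factor = solve-∀

act-· : ∀ {n} (p q : Laurent n) φ → act (p · q) φ ≗ act p (act q φ)
act-· []            q φ e = refl
act-· ((c , a) ∷ p) q φ e = trans (act-++ (map ((c , a) ·ᵗ_) q) (p · q) φ e)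
  (cong₂ ℤ._+_ (act-·ᵗ c a q φ e) (act-· p q φ e))

act-0 : ∀ {n} (p : Laurent n) e → act p (λ _ → 0ℤ) e ≡ 0ℤ
act-0 []            e = refl
act-0 ((c , a) ∷ p) e = cong₂ ℤ._+_ (ℤ.*-zeroʳ c) (act-0 p e)

act-linear : ∀ {n} (p : Laurent n) c a φ ψ e →
  act p (λ e → c ℤ.* φ (e ⊖ a) ℤ.+ ψ e) e ≡ c ℤ.* act p φ (e ⊖ a) ℤ.+ act p ψ e
act-linear []            c a φ ψ e = sym (trans (ℤ.+-identityʳ _) (ℤ.*-zeroʳ c))
act-linear ((d , b) ∷ p) c a φ ψ e = trans
  (cong₂ (λ i j → d ℤ.* (c ℤ.* φ i ℤ.+ ψ (e ⊖ b)) ℤ.+ j) (⊖-comm e b a) (act-linear p c a φ ψ e))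
  (regroup d c _ _ _ _)
  where
  regroup : ∀ d c x y u v →
    d ℤ.* (c ℤ.* x ℤ.+ y) ℤ.+ (c ℤ.* u ℤ.+ v) ≡ c ℤ.* (d ℤ.* x ℤ.+ u) ℤ.+ (d ℤ.* y ℤ.+ v)
  regroup = solve-∀

act-comm : ∀ {n} (p q : Laurent n) φ → act p (act q φ) ≗ act q (act p φ)
act-comm []            q φ e = sym (act-0 q e)
act-comm ((c , a) ∷ p) q φ e = trans
  (cong (λ i → c ℤ.* act q φ (e ⊖ a) ℤ.+ i) (act-comm p q φ e))
  (sym (act-linear q c a φ (act p φ) e))

coeffOfProduct≡act : ∀ {n} (p : Laurent n) F → coeffOfProduct p F ≗ act p (coeffˢ F)
coeffOfProduct≡act []            F e = refl
coeffOfProduct≡act ((c , a) ∷ p) F e =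
  cong (λ i → c ℤ.* coeffˢ F (e ⊖ a) ℤ.+ i) (coeffOfProduct≡act p F e)

1ᴸ : ∀ {n} → Laurent n
1ᴸ = monomial 0ᵉ

δ : ∀ {n} → Exponent n → ℤ
δ = coeff 1ᴸ

-- Since `δ` is the coefficient function of 1, products of Laurent polynomials become compositions
-- of commuting operators.
coeff≡act : ∀ {n} (p : Laurent n) → coeff p ≗ act p δ
coeff≡act []            e = refl
coeff≡act ((c , a) ∷ p) e with a ≟ᵉ e | 0ᵉ ≟ᵉ (e ⊖ a)
... | yes _    | yes _   = cong₂ ℤ._+_ (sym (ℤ.*-identityʳ c)) (coeff≡act p e)
... | no  _    | no  _   = trans (coeff≡act p e)
  (sym (trans (cong (ℤ._+ act p δ e) (ℤ.*-zeroʳ c)) (ℤ.+-identityˡ _)))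
... | yes refl | no  0≢  = contradiction (sym (⊖-self a)) 0≢
... | no  a≢e  | yes 0≡  = contradiction (⊖≡0⇒≡ e a 0≡) a≢e

coeff-· : ∀ {n} (p q : Laurent n) → coeff (p · q) ≗ act p (coeff q)
coeff-· p q e = begin
  coeff (p · q) e    ≡⟨ coeff≡act (p · q) e ⟩
  act (p · q) δ e    ≡⟨ act-· p q δ e ⟩
  act p (act q δ) e  ≡⟨ act-cong p (coeff≡act q) e ⟨
  act p (coeff q) e  ∎
  where open ≡-Reasoning

coeff-·ʳ : ∀ {n} (p q : Laurent n) → coeff (p · q) ≗ act q (coeff p)
coeff-·ʳ p q e = begin
  coeff (p · q) e    ≡⟨ coeff≡act (p · q) e ⟩
  act (p · q) δ e    ≡⟨ act-· p q δ e ⟩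
  act p (act q δ) e  ≡⟨ act-comm p q δ e ⟩
  act q (act p δ) e  ≡⟨ act-cong q (coeff≡act p) e ⟨
  act q (coeff p) e  ∎
  where open ≡-Reasoning

-- x^(-m) φ(1/x)
reflect : ∀ {n} → Exponent n → (Exponent n → ℤ) → Exponent n → ℤ
reflect m φ e = φ (-ᵉ e ⊖ m)

reflect-⊖ : ∀ {n} (m e a : Exponent n) → -ᵉ (e ⊖ (-ᵉ a)) ⊖ m ≡ -ᵉ e ⊖ m ⊖ a
reflect-⊖ []      []      []      = refl
reflect-⊖ (k ∷ m) (i ∷ e) (j ∷ a) = cong₂ _∷_ (rearrange k i j) (reflect-⊖ m e a)
  where
  rearrange : ∀ k i j → - (i ℤ.+ - - j) ℤ.+ - k ≡ - i ℤ.+ - k ℤ.+ - j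
  rearrange = solve-∀

-- Reflection turns a shift by a into a shift by -a. Thus a denominator of f, with its variables
-- inverted, acts on the reflected series as the original denominator acts on the series.
act-invertVars : ∀ {n} m (p : Laurent n) φ →
  act (invertVars p) (reflect m φ) ≗ reflect m (act p φ)
act-invertVars m []            φ e = refl
act-invertVars m ((c , a) ∷ p) φ e =
  cong₂ (λ i j → c ℤ.* φ i ℤ.+ j) (reflect-⊖ m e a) (act-invertVars m p φ e)

⊖-neg : ∀ {n} (e m : Exponent n) → e ⊖ (-ᵉ m) ≡ -ᵉ (-ᵉ e ⊖ m)
⊖-neg []      []      = refl
⊖-neg (i ∷ e) (j ∷ m) = cong₂ _∷_ (rearrange i j) (⊖-neg e m)
  where
  rearrange : ∀ i j → i ℤ.+ - - j ≡ - (- i ℤ.+ - j)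
  rearrange = solve-∀

coeff-monomial·invertVars : ∀ {n} m (p : Laurent n) →
  coeff (monomial (-ᵉ m) · invertVars p) ≗ reflect m (coeff p)
coeff-monomial·invertVars m p e = begin
  coeff (monomial (-ᵉ m) · invertVars p) e
    ≡⟨ coeff-· (monomial (-ᵉ m)) (invertVars p) e ⟩
  1ℤ ℤ.* coeff (invertVars p) (e ⊖ (-ᵉ m)) ℤ.+ 0ℤ
    ≡⟨ trans (ℤ.+-identityʳ _) (ℤ.*-identityˡ _) ⟩
  coeff (invertVars p) (e ⊖ (-ᵉ m))
    ≡⟨ cong (coeff (invertVars p)) (⊖-neg e m) ⟩
  coeff (invertVars p) (-ᵉ (-ᵉ e ⊖ m))
    ≡⟨ coeff-invertVars p (-ᵉ e ⊖ m) ⟩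
  reflect m (coeff p) e ∎
  where open ≡-Reasoning

-- Products of binomials 1 - x^a

Δ : ∀ {n} → Vec ℕ n → (Exponent n → ℤ) → Exponent n → ℤ
Δ a φ e = φ e ℤ.- φ (e ⊖ ⁺ a)

Δ* : ∀ {n} → List (Vec ℕ n) → (Exponent n → ℤ) → Exponent n → ℤ
Δ* []       φ = φ
Δ* (a ∷ as) φ = Δ a (Δ* as φ)

Δ-cong : ∀ {n} (a : Vec ℕ n) {φ ψ} → φ ≗ ψ → Δ a φ ≗ Δ a ψ
Δ-cong a φ≗ψ e = cong₂ ℤ._-_ (φ≗ψ e) (φ≗ψ (e ⊖ ⁺ a))

binomial : ∀ {n} → Vec ℕ n → Laurent n
binomial a = (1ℤ , 0ᵉ) ∷ (-1ℤ , ⁺ a) ∷ []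

binomials : ∀ {n} → List (Vec ℕ n) → Laurent n
binomials = foldr (λ a p → binomial a · p) 1ᴸ

act-binomial : ∀ {n} (a : Vec ℕ n) φ → act (binomial a) φ ≗ Δ a φ
act-binomial a φ e = trans
  (cong (λ i → 1ℤ ℤ.* φ i ℤ.+ (-1ℤ ℤ.* φ (e ⊖ ⁺ a) ℤ.+ 0ℤ)) (⊖-identityʳ e))
  (simplify (φ e) (φ (e ⊖ ⁺ a)))
  where
  simplify : ∀ x y → 1ℤ ℤ.* x ℤ.+ (-1ℤ ℤ.* y ℤ.+ 0ℤ) ≡ x ℤ.- y
  simplify = solve-∀

act-binomials : ∀ {n} (as : List (Vec ℕ n)) φ → act (binomials as) φ ≗ Δ* as φ
act-binomials []       φ e =
  trans (ℤ.+-identityʳ _) (trans (ℤ.*-identityˡ _) (cong φ (⊖-identityʳ e)))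
act-binomials (a ∷ as) φ e = begin
  act (binomial a · binomials as) φ e       ≡⟨ act-· (binomial a) (binomials as) φ e ⟩
  act (binomial a) (act (binomials as) φ) e ≡⟨ act-binomial a (act (binomials as) φ) e ⟩
  Δ a (act (binomials as) φ) e              ≡⟨ Δ-cong a (act-binomials as φ) e ⟩
  Δ* (a ∷ as) φ e                           ∎
  where open ≡-Reasoning

Δ*-cong : ∀ {n} (as : List (Vec ℕ n)) {φ ψ} → φ ≗ ψ → Δ* as φ ≗ Δ* as ψ
Δ*-cong []       φ≗ψ = φ≗ψ
Δ*-cong (a ∷ as) φ≗ψ = Δ-cong a (Δ*-cong as φ≗ψ)

Δ*-act : ∀ {n} (as : List (Vec ℕ n)) p φ → Δ* as (act p φ) ≗ act p (Δ* as φ)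
Δ*-act as p φ e = begin
  Δ* as (act p φ) e              ≡⟨ act-binomials as (act p φ) e ⟨
  act (binomials as) (act p φ) e ≡⟨ act-comm (binomials as) p φ e ⟩
  act p (act (binomials as) φ) e ≡⟨ act-cong p (act-binomials as φ) e ⟩
  act p (Δ* as φ) e              ∎
  where open ≡-Reasoning

-- Bounded supports and cancellation of binomials

BoundedBelow BoundedAbove : ∀ {n} → (Exponent n → ℤ) → Set
BoundedBelow φ = ∃[ m ] ∀ e i → lookup e i ℤ.< m → φ e ≡ 0ℤ
BoundedAbove φ = ∃[ m ] ∀ e i → m ℤ.< lookup e i → φ e ≡ 0ℤ

Δ-below : ∀ {n} (a : Vec ℕ n) {φ} → BoundedBelow φ → BoundedBelow (Δ a φ)
Δ-below a {φ} (m , φ≡0) = m , λ e i eᵢ<m → cong₂ ℤ._-_ (φ≡0 e i eᵢ<m)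
  (φ≡0 (e ⊖ ⁺ a) i (ℤ.≤-<-trans
    (subst (ℤ._≤ lookup e i) (sym (lookup-⊖⁺ e a i)) (ℤ.i-j≤i (lookup e i) (+ lookup a i))) eᵢ<m))

lookup≤sum : ∀ {n} (a : Vec ℕ n) i → lookup a i ℕ.≤ Vec.sum a
lookup≤sum (k ∷ a) zero    = ℕ.m≤m+n k _
lookup≤sum (k ∷ a) (suc i) = ℕ.m≤n⇒m≤o+n k (lookup≤sum a i)

Δ-above : ∀ {n} (a : Vec ℕ n) {φ} → BoundedAbove φ → BoundedAbove (Δ a φ)
Δ-above a {φ} (m , φ≡0) = m ℤ.+ + Vec.sum a , λ e i m+a<eᵢ → cong₂ ℤ._-_
  (φ≡0 e i (ℤ.≤-<-trans (ℤ.i≤i+j m (+ Vec.sum a)) m+a<eᵢ))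
  (φ≡0 (e ⊖ ⁺ a) i (subst (m ℤ.<_) (sym (lookup-⊖⁺ e a i))
    (subst (ℤ._< lookup e i ℤ.- + lookup a i) (cancel m (+ lookup a i))
      (ℤ.+-monoˡ-< (- (+ lookup a i))
        (ℤ.≤-<-trans (ℤ.+-monoʳ-≤ m (ℤ.+≤+ (lookup≤sum a i))) m+a<eᵢ)))))
  where
  cancel : ∀ i j → i ℤ.+ j ℤ.- j ≡ i
  cancel = solve-∀

Δ*-below : ∀ {n} (as : List (Vec ℕ n)) {φ} → BoundedBelow φ → BoundedBelow (Δ* as φ)
Δ*-below []       = λ b → b
Δ*-below (a ∷ as) = Δ-below a ∘ Δ*-below as

Δ*-above : ∀ {n} (as : List (Vec ℕ n)) {φ} → BoundedAbove φ → BoundedAbove (Δ* as φ)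
Δ*-above []       = λ b → b
Δ*-above (a ∷ as) = Δ-above a ∘ Δ*-above as

lowest : ∀ {n} → Exponent n → ℤ
lowest []      = 0ℤ
lowest (i ∷ e) = i ℤ.⊓ lowest e

lowest≤lookup : ∀ {n} (e : Exponent n) i → lowest e ℤ.≤ lookup e i
lowest≤lookup (j ∷ e) zero    = ℤ.i⊓j≤i j (lowest e)
lowest≤lookup (j ∷ e) (suc i) = ℤ.≤-trans (ℤ.i⊓j≤j j (lowest e)) (lowest≤lookup e i)

coeff-below : ∀ {n} (p : Laurent n) → BoundedBelow (coeff p)
coeff-below []            = 0ℤ , λ _ _ _ → refl
coeff-below ((c , a) ∷ p) with coeff-below p
... | m , p≡0 = m ℤ.⊓ lowest a , vanish
  where
  vanish : ∀ e i → lookup e i ℤ.< m ℤ.⊓ lowest a → coeff ((c , a) ∷ p) e ≡ 0ℤ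
  vanish e i eᵢ< with a ≟ᵉ e
  ... | no  _    = p≡0 e i (ℤ.<-≤-trans eᵢ< (ℤ.i⊓j≤i m (lowest a)))
  ... | yes refl = contradiction
    (ℤ.<-≤-trans eᵢ< (ℤ.≤-trans (ℤ.i⊓j≤j m (lowest a)) (lowest≤lookup a i))) (ℤ.<-irrefl refl)

Nonzero : ∀ {n} → Vec ℕ n → Set
Nonzero a = ∃[ i ] 0 ℕ.< lookup a i

i<m+∣i-m∣+1 : ∀ i m → i ℤ.< m ℤ.+ + suc ℤ.∣ i ℤ.- m ∣
i<m+∣i-m∣+1 i m = ℤ.≤-<-trans i≤ (ℤ.+-monoʳ-< m (ℤ.+<+ (ℕ.n<1+n _)))
  where
  split : ∀ i m → m ℤ.+ (i ℤ.- m) ≡ i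
  split = solve-∀
  i≤∣i∣ : ∀ i → i ℤ.≤ + ℤ.∣ i ∣
  i≤∣i∣ (+ n)    = ℤ.≤-refl
  i≤∣i∣ -[1+ n ] = ℤ.-≤+
  i≤ : i ℤ.≤ m ℤ.+ + ℤ.∣ i ℤ.- m ∣
  i≤ = subst (ℤ._≤ m ℤ.+ + ℤ.∣ i ℤ.- m ∣) (split i m) (ℤ.+-monoʳ-≤ m (i≤∣i∣ (i ℤ.- m)))

i<m+1+N⇒i≤m+N : ∀ {i} m N → i ℤ.< m ℤ.+ + suc N → i ℤ.≤ m ℤ.+ + N
i<m+1+N⇒i≤m+N {i} m N i< = subst (i ℤ.≤_) (pred-+ m (+ N)) (ℤ.i<j⇒i≤pred[j] i<)
  where
  pred-+ : ∀ i j → -1ℤ ℤ.+ (i ℤ.+ (1ℤ ℤ.+ j)) ≡ i ℤ.+ j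
  pred-+ = solve-∀

-- On two-sided functions 1 - x^a kills everything periodic along a, so cancellation rests on the
-- lower bounds: subtracting a repeatedly lowers coordinate i until both functions vanish. The
-- distance of that coordinate from the common bound limits the number of subtractions.
Δ-cancel : ∀ {n} (a : Vec ℕ n) → Nonzero a → ∀ {φ ψ} → BoundedBelow φ → BoundedBelow ψ →
  Δ a φ ≗ Δ a ψ → φ ≗ ψ
Δ-cancel a (i , 0<aᵢ) {φ} {ψ} (m₁ , φ≡0) (m₂ , ψ≡0) Δφ≗Δψ e =
  descend (suc ℤ.∣ lookup e i ℤ.- m ∣) e (i<m+∣i-m∣+1 (lookup e i) m)
  where
  m = m₁ ℤ.⊓ m₂
  step : ∀ e → lookup (e ⊖ ⁺ a) i ℤ.< lookup e i
  step e = subst₂ ℤ._<_ (sym (lookup-⊖⁺ e a i)) (ℤ.+-identityʳ (lookup e i))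
    (ℤ.+-monoʳ-< (lookup e i) (ℤ.neg-mono-< (ℤ.+<+ 0<aᵢ)))
  descend : ∀ N e → lookup e i ℤ.< m ℤ.+ + N → φ e ≡ ψ e
  descend zero    e eᵢ< = trans
    (φ≡0 e i (ℤ.<-≤-trans eᵢ<m (ℤ.i⊓j≤i m₁ m₂)))
    (sym (ψ≡0 e i (ℤ.<-≤-trans eᵢ<m (ℤ.i⊓j≤j m₁ m₂))))
    where eᵢ<m = subst (lookup e i ℤ.<_) (ℤ.+-identityʳ m) eᵢ<
  descend (suc N) e eᵢ< = begin
    φ e                       ≡⟨ split (φ e) _ ⟩
    Δ a φ e ℤ.+ φ (e ⊖ ⁺ a)   ≡⟨ cong₂ ℤ._+_ (Δφ≗Δψ e) (descend N (e ⊖ ⁺ a) e-a<) ⟩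
    Δ a ψ e ℤ.+ ψ (e ⊖ ⁺ a)   ≡⟨ split (ψ e) _ ⟨
    ψ e                       ∎
    where
    open ≡-Reasoning
    split : ∀ x y → x ≡ x ℤ.- y ℤ.+ y
    split = solve-∀
    e-a< : lookup (e ⊖ ⁺ a) i ℤ.< m ℤ.+ + N
    e-a< = ℤ.<-≤-trans (step e) (i<m+1+N⇒i≤m+N m N eᵢ<)

Δ*-cancel : ∀ {n} {as : List (Vec ℕ n)} → All Nonzero as → ∀ {φ ψ} →
  BoundedBelow φ → BoundedBelow ψ → Δ* as φ ≗ Δ* as ψ → φ ≗ ψ
Δ*-cancel                []          φ↓ ψ↓ eq = eq
Δ*-cancel {as = a ∷ as} (a≢0 ∷ as≢0) φ↓ ψ↓ eq = Δ*-cancel as≢0 φ↓ ψ↓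
  (Δ-cancel a a≢0 (Δ*-below as φ↓) (Δ*-below as ψ↓) eq)

Δ*-0 : ∀ {n} (as : List (Vec ℕ n)) e → Δ* as (λ _ → 0ℤ) e ≡ 0ℤ
Δ*-0 as e = trans (sym (act-binomials as _ e)) (act-0 (binomials as) e)

-- A zero product would kill `δ`, and by cancellation `δ` itself would be zero, but its value at
-- exponent 0 is 1.
binomials≉0 : ∀ {n} {as : List (Vec ℕ n)} → All Nonzero as → ¬ (binomials as ≋ [])
binomials≉0 {n} {as} as≢0 den≋0 = 1≢0 (trans (sym δ-0)
  (Δ*-cancel as≢0 (coeff-below (1ᴸ {n})) (0ℤ , λ _ _ _ → refl) Δδ≡0 0ᵉ))
  where
  1≢0 : 1ℤ ≢ 0ℤ
  1≢0 ()
  δ-0 : δ (0ᵉ {n}) ≡ 1ℤ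
  δ-0 with 0ᵉ {n} ≟ᵉ 0ᵉ
  ... | yes _  = refl
  ... | no 0≢0 = contradiction refl 0≢0
  Δδ≡0 : Δ* as (δ {n}) ≗ Δ* as (λ _ → 0ℤ)
  Δδ≡0 e = begin
    Δ* as δ e             ≡⟨ act-binomials as δ e ⟨
    act (binomials as) δ e ≡⟨ coeff≡act (binomials as) e ⟨
    coeff (binomials as) e ≡⟨ den≋0 e ⟩
    0ℤ                    ≡⟨ Δ*-0 as e ⟨
    Δ* as (λ _ → 0ℤ) e    ∎
    where open ≡-Reasoning

-- Laurent polynomials from functions of finite support

Finite : ∀ {n} → (Exponent n → ℤ) → Set
Finite φ = ∃[ p ] coeff p ≗ φ

prependTerm : ∀ {n} → ℤ → Term n → Term (suc n)
prependTerm k (c , a) = c , k ∷ a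

coeff-∷-cong : ∀ {m n} c {a e : Exponent m} {b g : Exponent n} p q →
  (a ≡ e → b ≡ g) → (b ≡ g → a ≡ e) → coeff p e ≡ coeff q g →
  coeff ((c , a) ∷ p) e ≡ coeff ((c , b) ∷ q) g
coeff-∷-cong c {a} {e} {b} {g} p q to from eq with a ≟ᵉ e | b ≟ᵉ g
... | yes _   | yes _   = cong (λ i → c ℤ.+ i) eq
... | no  _   | no  _   = eq
... | yes a≡e | no  b≢g = contradiction (to a≡e) b≢g
... | no  a≢e | yes b≡g = contradiction (from b≡g) a≢e

coeff-∷-≢ : ∀ {n} c {a e : Exponent n} p → a ≢ e → coeff ((c , a) ∷ p) e ≡ coeff p e
coeff-∷-≢ c {a} {e} p a≢e with a ≟ᵉ e
... | yes a≡e = contradiction a≡e a≢e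
... | no  _   = refl

coeff-prepend-≡ : ∀ {n} k (p : Laurent n) e → coeff (map (prependTerm k) p) (k ∷ e) ≡ coeff p e
coeff-prepend-≡ k []            e = refl
coeff-prepend-≡ k ((c , a) ∷ p) e =
  coeff-∷-cong c _ p Vec.∷-injectiveʳ (cong (k ∷_)) (coeff-prepend-≡ k p e)

coeff-prepend-≢ : ∀ {n} {k l} → k ≢ l → ∀ (p : Laurent n) e → coeff (map (prependTerm k) p) (l ∷ e) ≡ 0ℤ
coeff-prepend-≢         k≢l []            e = refl
coeff-prepend-≢ k≢l ((c , a) ∷ p) e =
  trans (coeff-∷-≢ c _ (k≢l ∘ Vec.∷-injectiveˡ)) (coeff-prepend-≢ k≢l p e)

coeff-++ : ∀ {n} (p q : Laurent n) e → coeff (p ++ q) e ≡ coeff p e ℤ.+ coeff q e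
coeff-++ []            q e = sym (ℤ.+-identityˡ _)
coeff-++ ((c , a) ∷ p) q e with a ≟ᵉ e
... | yes _ = trans (cong (λ i → c ℤ.+ i) (coeff-++ p q e)) (sym (ℤ.+-assoc c _ _))
... | no  _ = coeff-++ p q e

-- Adds up one Laurent polynomial per value of the first exponent, taking the slices of the window
-- from the top; `rest` is φ with its top slice set to zero.
finite-slices : ∀ {n} (φ : Exponent (suc n) → ℤ) (l : ℤ) (N : ℕ) →
  (∀ k → Finite (λ e → φ (k ∷ e))) →
  (∀ k e → k ℤ.< l → φ (k ∷ e) ≡ 0ℤ) →
  (∀ k e → l ℤ.+ + N ℤ.≤ k → φ (k ∷ e) ≡ 0ℤ) →
  Finite φ
finite-slices φ l zero    slices below above = [] , zeros
  where
  zeros : ∀ e → 0ℤ ≡ φ e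
  zeros (k ∷ e) with k ℤ.<? l
  ... | yes k<l = sym (below k e k<l)
  ... | no  k≮l = sym (above k e (subst (ℤ._≤ k) (sym (ℤ.+-identityʳ l)) (ℤ.≮⇒≥ k≮l)))
finite-slices {n} φ l (suc N) slices below above with finite-slices rest l N slices′ below′ above′
  where
  top = l ℤ.+ + N
  rest : Exponent (suc n) → ℤ
  rest (k ∷ e) with top ℤ.≟ k
  ... | yes _ = 0ℤ
  ... | no  _ = φ (k ∷ e)
  slices′ : ∀ k → Finite (λ e → rest (k ∷ e))
  slices′ k with top ℤ.≟ k
  ... | yes _ = [] , λ _ → refl
  ... | no  _ = slices k
  below′ : ∀ k e → k ℤ.< l → rest (k ∷ e) ≡ 0ℤ
  below′ k e k<l with top ℤ.≟ k
  ... | yes _ = refl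
  ... | no  _ = below k e k<l
  above′ : ∀ k e → top ℤ.≤ k → rest (k ∷ e) ≡ 0ℤ
  above′ k e top≤k with top ℤ.≟ k
  ... | yes _     = refl
  ... | no  top≢k = above k e (subst (ℤ._≤ k) (suc-+ l (+ N)) (ℤ.i<j⇒suc[i]≤j (ℤ.≤∧≢⇒< top≤k top≢k)))
    where
    suc-+ : ∀ i j → 1ℤ ℤ.+ (i ℤ.+ j) ≡ i ℤ.+ (1ℤ ℤ.+ j)
    suc-+ = solve-∀
... | p , p≗rest = map (prependTerm (l ℤ.+ + N)) q ++ p , eq
  where
  q = proj₁ (slices (l ℤ.+ + N))
  eq : coeff (map (prependTerm (l ℤ.+ + N)) q ++ p) ≗ φ
  -- Both equations are taken before the case split, so that the split also evaluates `rest` in the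
  -- type of `pₖ`.
  eq (k ∷ e) with coeff-++ (map (prependTerm (l ℤ.+ + N)) q) p (k ∷ e) | p≗rest (k ∷ e)
  ... | sum | pₖ with (l ℤ.+ + N) ℤ.≟ k
  ... | yes refl = trans sum (trans
    (cong₂ ℤ._+_ (trans (coeff-prepend-≡ _ q e) (proj₂ (slices _) e)) pₖ) (ℤ.+-identityʳ _))
  ... | no  top≢k = trans sum (trans
    (cong₂ ℤ._+_ (coeff-prepend-≢ top≢k q e) pₖ) (ℤ.+-identityˡ _))

finite-box : ∀ {n} (φ : Exponent n → ℤ) → BoundedBelow φ → BoundedAbove φ → Finite φ
finite-box {zero}  φ _ _ = (φ [] , []) ∷ [] , λ where [] → ℤ.+-identityʳ (φ [])
finite-box {suc n} φ (l , below) (h , above) = finite-slices φ l (suc ℤ.∣ h ℤ.- l ∣)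
  (λ k → finite-box (λ e → φ (k ∷ e))
    (l , λ e i → below (k ∷ e) (suc i)) (h , λ e i → above (k ∷ e) (suc i)))
  (λ k e → below (k ∷ e) zero)
  (λ k e ≤k → above (k ∷ e) zero (ℤ.<-≤-trans (i<m+∣i-m∣+1 h l) ≤k))

-- From reciprocity of coefficients to the functional equation

coeffˢ-below : ∀ {n} (F : PowerSeries n) e i → lookup e i ℤ.< 0ℤ → coeffˢ F e ≡ 0ℤ
coeffˢ-below F (+ k      ∷ e) zero    (ℤ.+<+ ())
coeffˢ-below F (+ k      ∷ e) (suc i) eᵢ<0 = coeffˢ-below (λ e′ → F (k ∷ e′)) e i eᵢ<0
coeffˢ-below F (-[1+ _ ] ∷ e) _       _    = refl

reflect-above : ∀ {n} (m : Exponent n) {φ} → (∀ e i → lookup e i ℤ.< 0ℤ → φ e ≡ 0ℤ) →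
  BoundedAbove (reflect m φ)
reflect-above m φ≡0 = - lowest m , λ e i -m<eᵢ → φ≡0 (-ᵉ e ⊖ m) i
  (subst (ℤ._< 0ℤ) (sym (trans (lookup-⊖ (-ᵉ e) m i)
      (cong (ℤ._- lookup m i) (Vec.lookup-map i (λ j → - j) e))))
    (subst (- lookup e i ℤ.- lookup m i ℤ.<_) (ℤ.+-inverseʳ (lookup m i))
      (ℤ.+-monoˡ-< (- lookup m i) (ℤ.<-≤-trans
        (subst (- lookup e i ℤ.<_) (ℤ.neg-involutive (lowest m)) (ℤ.neg-mono-< -m<eᵢ)) (lowest≤lookup m i)))))

module _ {n : ℕ} (F : PowerSeries n) (m : Exponent n) (as : List (Vec ℕ n)) (as≢0 : All Nonzero as)
  (reciprocal : Δ* as (coeffˢ F) ≗ Δ* as (reflect m (coeffˢ F))) where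

  private
    φ = coeffˢ F

    -- The lower bound comes from the series; the upper bound comes from its reflection, which
    -- `reciprocal` makes equal after the binomials have acted. A Laurent polynomial with these
    -- coefficients is the numerator of the expansion.
    ΔF-finite : Finite (Δ* as φ)
    ΔF-finite = finite-box (Δ* as φ) (Δ*-below as (0ℤ , coeffˢ-below F)) ΔF-above
      where
      ΔF-above : BoundedAbove (Δ* as φ)
      ΔF-above with Δ*-above as (reflect-above m (coeffˢ-below F))
      ... | h , above = h , λ e i h<eᵢ → trans (reciprocal e) (above e i h<eᵢ)

  expansion : ∃[ f ] F IsExpansionOf f
  expansion = record { num = proj₁ ΔF-finite ; den = binomials as ; den≉0 = binomials≉0 as≢0 } , λ e → begin
    coeffOfProduct (binomials as) F e ≡⟨ coeffOfProduct≡act (binomials as) F e ⟩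
    act (binomials as) φ e            ≡⟨ act-binomials as φ e ⟩
    Δ* as φ e                         ≡⟨ proj₂ ΔF-finite e ⟨
    coeff (proj₁ ΔF-finite) e         ∎
    where open ≡-Reasoning

  -- The binomials cannot be cancelled from `reciprocal` itself, whose two functions are bounded on
  -- opposite sides. Once `d` and `d′` act as well, the two sides come from the cross-multiplied
  -- numerators; these are Laurent polynomials, where cancellation is valid. The denominator of f
  -- may be arbitrary, because all these operators commute.
  functionalEquation : ∀ f → F IsExpansionOf f → f ≈ x^ (-ᵉ m) * (f ⟨1/x⟩)
  functionalEquation f F-f = Δ*-cancel as≢0
    (coeff-below (num f · den g)) (coeff-below (num g · den f)) λ e → begin
    Δ* as (coeff (num f · den g)) e             ≡⟨ Δ*-cong as left e ⟩
    Δ* as (act d (act d′ φ)) e                  ≡⟨ through φ e ⟩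
    act d (act d′ (Δ* as φ)) e                  ≡⟨ act-cong d (act-cong d′ reciprocal) e ⟩
    act d (act d′ (Δ* as (reflect m φ))) e      ≡⟨ through (reflect m φ) e ⟨
    Δ* as (act d (act d′ (reflect m φ))) e      ≡⟨ Δ*-cong as right e ⟨
    Δ* as (coeff (num g · den f)) e             ∎
    where
    open ≡-Reasoning
    g  = x^ (-ᵉ m) * (f ⟨1/x⟩)
    d  = den f
    d′ = invertVars d
    numerator : coeff (num f) ≗ act d φ
    numerator e = trans (sym (F-f e)) (coeffOfProduct≡act d F e)
    through : ∀ ψ → Δ* as (act d (act d′ ψ)) ≗ act d (act d′ (Δ* as ψ))
    through ψ e = trans (Δ*-act as d (act d′ ψ) e) (act-cong d (Δ*-act as d′ ψ) e)
    left : coeff (num f · d′) ≗ act d (act d′ φ)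
    left e = begin
      coeff (num f · d′) e   ≡⟨ coeff-·ʳ (num f) d′ e ⟩
      act d′ (coeff (num f)) e ≡⟨ act-cong d′ numerator e ⟩
      act d′ (act d φ) e     ≡⟨ act-comm d′ d φ e ⟩
      act d (act d′ φ) e     ∎
    right : coeff (num g · d) ≗ act d (act d′ (reflect m φ))
    right e = trans (coeff-·ʳ (num g) d e) (act-cong d (λ e → begin
      coeff (num g) e               ≡⟨ coeff-monomial·invertVars m (num f) e ⟩
      reflect m (coeff (num f)) e   ≡⟨ numerator (-ᵉ e ⊖ m) ⟩
      reflect m (act d φ) e         ≡⟨ act-invertVars m d φ e ⟨
      act d′ (reflect m φ) e        ∎) e)

-- The recurrences and their duality

∇ : ℕ → (ℤ → ℤ) → ℤ → ℤ
∇ w φ k = φ k ℤ.- φ (k ℤ.- + w)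

∇* : List ℕ → (ℤ → ℤ) → ℤ → ℤ
∇* []       φ = φ
∇* (w ∷ ws) φ = ∇ w (∇* ws φ)

∇*-cong : ∀ ws {φ ψ} → φ ≗ ψ → ∇* ws φ ≗ ∇* ws ψ
∇*-cong []       φ≗ψ   = φ≗ψ
∇*-cong (w ∷ ws) φ≗ψ k = cong₂ ℤ._-_ (∇*-cong ws φ≗ψ k) (∇*-cong ws φ≗ψ (k ℤ.- + w))

∇*-+ : ∀ ws φ ψ k → ∇* ws (λ k → φ k ℤ.+ ψ k) k ≡ ∇* ws φ k ℤ.+ ∇* ws ψ k
∇*-+ []       φ ψ k = refl
∇*-+ (w ∷ ws) φ ψ k = trans (cong₂ ℤ._-_ (∇*-+ ws φ ψ k) (∇*-+ ws φ ψ (k ℤ.- + w)))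
  (regroup (∇* ws φ k) (∇* ws ψ k) (∇* ws φ (k ℤ.- + w)) (∇* ws ψ (k ℤ.- + w)))
  where
  regroup : ∀ a b c d → a ℤ.+ b ℤ.- (c ℤ.+ d) ≡ a ℤ.- c ℤ.+ (b ℤ.- d)
  regroup = solve-∀

∇*-neg : ∀ ws φ k → ∇* ws (λ k → - φ k) k ≡ - ∇* ws φ k
∇*-neg []       φ k = refl
∇*-neg (w ∷ ws) φ k = trans (cong₂ ℤ._-_ (∇*-neg ws φ k) (∇*-neg ws φ (k ℤ.- + w)))
  (factor (∇* ws φ k) (∇* ws φ (k ℤ.- + w)))
  where
  factor : ∀ a b → - a ℤ.- - b ≡ - (a ℤ.- b)
  factor = solve-∀

∇*-0 : ∀ ws k → ∇* ws (λ _ → 0ℤ) k ≡ 0ℤ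
∇*-0 []       k = refl
∇*-0 (w ∷ ws) k = cong₂ ℤ._-_ (∇*-0 ws k) (∇*-0 ws (k ℤ.- + w))

∇*-shift : ∀ ws φ i k → ∇* ws (λ k → φ (k ℤ.- i)) k ≡ ∇* ws φ (k ℤ.- i)
∇*-shift []       φ i k = refl
∇*-shift (w ∷ ws) φ i k = cong₂ ℤ._-_ (∇*-shift ws φ i k)
  (trans (∇*-shift ws φ i (k ℤ.- + w)) (cong (∇* ws φ) (swap k (+ w) i)))
  where
  swap : ∀ k w i → k ℤ.- w ℤ.- i ≡ k ℤ.- i ℤ.- w
  swap = solve-∀

𝟙₀ : ℤ → ℤ
𝟙₀ (+ 0)         = 1ℤ
𝟙₀ (+ (suc _))   = 0ℤ
𝟙₀ -[1+ _ ]      = 0ℤ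

Family : Set
Family = (r t : ℕ) (n k : ℤ) → ℤ

-- `step-n` separates d_t = d_{t-1}, which raises t, from d_t > d_{t-1}. `step-k` separates c₁ = 0,
-- where dropping c₁ lowers both r and t, from c₁ > 0. At t = r + 1 the only entry of d is dᵣ = -n,
-- so the count does not depend on n ≥ 0 and `step-n` forces zero at t = r + 2. `boundary` is the
-- empty range 1 ≤ d₀ ≤ 0.
record Solution (A : Family) : Set where
  field
    initial   : ∀ n k → A 0 1 n k ≡ 𝟙₀ k
    vanishing : ∀ r t n k → 2 + r ℕ.≤ t → A r t n k ≡ 0ℤ
    boundary  : ∀ r k → A r 0 -1ℤ k ≡ 0ℤ
    step-n    : ∀ r t n k → A r t (1ℤ ℤ.+ n) k ≡ A r t n k ℤ.+ A r (suc t) (1ℤ ℤ.+ n) k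
    step-k    : ∀ r t n k →
      A (suc r) (suc t) n k ≡ A r t n k ℤ.+ A (suc r) (suc t) (1ℤ ℤ.+ n) (k ℤ.- + suc r)

-- The induction starts at -1 because that is where `boundary` supplies a value.
ℤ-induction : (P : ℤ → Set) → P -1ℤ →
  (∀ n → P n → P (1ℤ ℤ.+ n)) → (∀ n → P (1ℤ ℤ.+ n) → P n) → ∀ n → P n
ℤ-induction P base up down (+ zero)       = up -1ℤ base
ℤ-induction P base up down (+ (suc n))    = up (+ n) (ℤ-induction P base up down (+ n))
ℤ-induction P base up down -[1+ zero ]    = base
ℤ-induction P base up down -[1+ (suc n) ] = down -[1+ suc n ] (ℤ-induction P base up down -[1+ n ])

-- Uniqueness of solutions up to products of 1 - x^w

module _ {A : Family} (solution : Solution A) where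

  open Solution solution

  ∇*-step-n : ∀ ws r t n k →
    ∇* ws (A r t (1ℤ ℤ.+ n)) k ≡ ∇* ws (A r t n) k ℤ.+ ∇* ws (A r (suc t) (1ℤ ℤ.+ n)) k
  ∇*-step-n ws r t n k = trans (∇*-cong ws (step-n r t n) k) (∇*-+ ws (A r t n) (A r (suc t) (1ℤ ℤ.+ n)) k)

  -- Applying `step-n` to the last term of `step-k` yields a copy of the left side shifted by r + 1,
  -- which moves over to form the factor 1 - x^(r+1), and a term with larger t. What remains on the
  -- right has either smaller r or larger t, which is the basis of the double induction.
  ∇*-step-k : ∀ ws r t n k → ∇* (suc r ∷ ws) (A (suc r) (suc t) n) k ≡
    ∇* ws (A r t n) k ℤ.+ ∇* ws (A (suc r) (2 + t) (1ℤ ℤ.+ n)) (k ℤ.- + suc r)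
  ∇*-step-k ws r t n k = trans (cong (ℤ._- ∇* ws (A (suc r) (suc t) n) (k ℤ.- + suc r)) expand)
    (cancel (∇* ws (A r t n) k) (∇* ws (A (suc r) (suc t) n) (k ℤ.- + suc r))
      (∇* ws (A (suc r) (2 + t) (1ℤ ℤ.+ n)) (k ℤ.- + suc r)))
    where
    open ≡-Reasoning
    cancel : ∀ a b c → a ℤ.+ (b ℤ.+ c) ℤ.- b ≡ a ℤ.+ c
    cancel = solve-∀
    A↑ = A (suc r) (suc t) (1ℤ ℤ.+ n)
    expand : ∇* ws (A (suc r) (suc t) n) k ≡ ∇* ws (A r t n) k ℤ.+
      (∇* ws (A (suc r) (suc t) n) (k ℤ.- + suc r) ℤ.+ ∇* ws (A (suc r) (2 + t) (1ℤ ℤ.+ n)) (k ℤ.- + suc r))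
    expand = begin
      ∇* ws (A (suc r) (suc t) n) k
        ≡⟨ ∇*-cong ws (step-k r t n) k ⟩
      ∇* ws (λ k → A r t n k ℤ.+ A↑ (k ℤ.- + suc r)) k
        ≡⟨ ∇*-+ ws (A r t n) (λ k → A↑ (k ℤ.- + suc r)) k ⟩
      ∇* ws (A r t n) k ℤ.+ ∇* ws (λ k → A↑ (k ℤ.- + suc r)) k
        ≡⟨ cong (λ i → ∇* ws (A r t n) k ℤ.+ i) (∇*-shift ws A↑ (+ suc r) k) ⟩
      ∇* ws (A r t n) k ℤ.+ ∇* ws A↑ (k ℤ.- + suc r)
        ≡⟨ cong (λ i → ∇* ws (A r t n) k ℤ.+ i) (∇*-step-n ws (suc r) (suc t) n (k ℤ.- + suc r)) ⟩
      _ ∎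

_Annihilates_-_ : List ℕ → Family → Family → ℕ → ℕ → Set
(ws Annihilates A - B) r t = ∀ n k → ∇* ws (A r t n) k ≡ ∇* ws (B r t n) k

module _ {A B : Family} (solA : Solution A) (solB : Solution B) where

  private
    module A = Solution solA
    module B = Solution solB

    annihilates-++ : ∀ ws {vs r t} → (vs Annihilates A - B) r t → ((ws ++ vs) Annihilates A - B) r t
    annihilates-++ []       eq n k = eq n k
    annihilates-++ (w ∷ ws) eq n k =
      cong₂ ℤ._-_ (annihilates-++ ws eq n k) (annihilates-++ ws eq n (k ℤ.- + w))

    annihilates-vanishing : ∀ ws r t → 2 + r ℕ.≤ t → (ws Annihilates A - B) r t
    annihilates-vanishing ws r t 2+r≤t n =
      ∇*-cong ws (λ k → trans (A.vanishing r t n k 2+r≤t) (sym (B.vanishing r t n k 2+r≤t)))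

    -- `step-k` has nothing to say about t = 0. There `step-n` gives the differences in n in terms
    -- of t = 1, and `boundary` the value from which to walk in both directions.
    annihilates-0 : ∀ ws r → (ws Annihilates A - B) r 1 → (ws Annihilates A - B) r 0
    annihilates-0 ws r eq = ℤ-induction (λ n → ∀ k → ∇* ws (A r 0 n) k ≡ ∇* ws (B r 0 n) k)
      (∇*-cong ws (λ k → trans (A.boundary r k) (sym (B.boundary r k))))
      (λ n eq₀ k → begin
        ∇* ws (A r 0 (1ℤ ℤ.+ n)) k                         ≡⟨ ∇*-step-n solA ws r 0 n k ⟩
        ∇* ws (A r 0 n) k ℤ.+ ∇* ws (A r 1 (1ℤ ℤ.+ n)) k   ≡⟨ cong₂ ℤ._+_ (eq₀ k) (eq _ k) ⟩
        ∇* ws (B r 0 n) k ℤ.+ ∇* ws (B r 1 (1ℤ ℤ.+ n)) k   ≡⟨ ∇*-step-n solB ws r 0 n k ⟨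
        ∇* ws (B r 0 (1ℤ ℤ.+ n)) k                         ∎)
      (λ n eq₀ k → ∙-cancelʳ ℤ.+-0-abelianGroup _ _ _ (begin
        ∇* ws (A r 0 n) k ℤ.+ ∇* ws (A r 1 (1ℤ ℤ.+ n)) k   ≡⟨ ∇*-step-n solA ws r 0 n k ⟨
        ∇* ws (A r 0 (1ℤ ℤ.+ n)) k                         ≡⟨ eq₀ k ⟩
        ∇* ws (B r 0 (1ℤ ℤ.+ n)) k                         ≡⟨ ∇*-step-n solB ws r 0 n k ⟩
        ∇* ws (B r 0 n) k ℤ.+ ∇* ws (B r 1 (1ℤ ℤ.+ n)) k   ≡⟨ cong (λ i → ∇* ws (B r 0 n) k ℤ.+ i) (eq _ k) ⟨
        ∇* ws (B r 0 n) k ℤ.+ ∇* ws (A r 1 (1ℤ ℤ.+ n)) k   ∎))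
      where open ≡-Reasoning

    -- Downward induction on t, with m an upper bound for the distance to the vanishing range. Each
    -- step costs one factor 1 - x^(r+1), and the claim covers all n and k because the recurrence
    -- moves both.
    annihilates-suc : ∀ ws r → (∀ t → (ws Annihilates A - B) r t) → ∀ m t → 2 + r ℕ.≤ t + m →
      ((replicate m (suc r) ++ ws) Annihilates A - B) (suc r) (suc t)
    annihilates-suc ws r eq zero    t 2+r≤ =
      annihilates-vanishing ws (suc r) (suc t) (ℕ.s≤s (subst (2 + r ℕ.≤_) (ℕ.+-identityʳ t) 2+r≤))
    annihilates-suc ws r eq (suc m) t 2+r≤ n k = begin
      ∇* (suc r ∷ vs) (A (suc r) (suc t) n) k
        ≡⟨ ∇*-step-k solA vs r t n k ⟩
      ∇* vs (A r t n) k ℤ.+ ∇* vs (A (suc r) (2 + t) (1ℤ ℤ.+ n)) (k ℤ.- + suc r)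
        -- The term of length r already agrees after `ws` alone, and further factors preserve the
        -- agreement.
        ≡⟨ cong₂ ℤ._+_ (annihilates-++ (replicate m (suc r)) {t = t} (eq t) n k)
             (annihilates-suc ws r eq m (suc t) (subst (2 + r ℕ.≤_) (ℕ.+-suc t m) 2+r≤) _ _) ⟩
      ∇* vs (B r t n) k ℤ.+ ∇* vs (B (suc r) (2 + t) (1ℤ ℤ.+ n)) (k ℤ.- + suc r)
        ≡⟨ ∇*-step-k solB vs r t n k ⟨
      ∇* (suc r ∷ vs) (B (suc r) (suc t) n) k ∎
      where
      open ≡-Reasoning
      vs = replicate m (suc r) ++ ws

  annihilator : ∀ r → ∃[ ws ] All (0 ℕ.<_) ws × (∀ t → (ws Annihilates A - B) r t)
  annihilator zero = [] , [] , λ where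
      zero          → annihilates-0 [] 0 eq₁
      (suc zero)    → eq₁
      (suc (suc t)) → annihilates-vanishing [] 0 (2 + t) (ℕ.s≤s (ℕ.s≤s ℕ.z≤n))
    where
    eq₁ : ([] Annihilates A - B) 0 1
    eq₁ n k = trans (A.initial n k) (sym (B.initial n k))
  annihilator (suc r) with annihilator r
  ... | ws , ws>0 , eq = vs , All.++⁺ (All.replicate⁺ (2 + r) ℕ.z<s) ws>0 , λ where
      zero    → annihilates-0 vs (suc r) (eq⁺ 0)
      (suc t) → eq⁺ t
    where
    -- From t = 0 the descent reaches the vanishing range in r + 2 steps, and the same number serves
    -- every larger t.
    vs = replicate (2 + r) (suc r) ++ ws
    eq⁺ : ∀ t → (vs Annihilates A - B) (suc r) (suc t)
    eq⁺ t = annihilates-suc ws r eq (2 + r) t (ℕ.m≤n+m (2 + r) t)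

triangular : ℕ → ℕ
triangular zero    = 0
triangular (suc r) = triangular r + suc r

sign : ℕ → ℤ
sign zero    = -1ℤ
sign (suc t) = - sign t

-- The exponents of both variables are reflected; t-2-n is the reflection of n forced by the
-- recurrence in n and by the zero at t = 0, n = -1.
dual : Family → Family
dual A r t n k = sign t ℤ.* A r t (+ t ℤ.- + 2 ℤ.- n) (- k ℤ.- + triangular r)

-- Reflecting n reverses `step-n`, which moves the term with t + 1 to the other side; the sign
-- alternating in t moves it back. In `step-k` the two terms of length r + 1 exchange places, and
-- their distance r + 1 in k is the increment of `triangular`.
dual-solution : ∀ {A} → Solution A → Solution (dual A)
dual-solution {A} solution = record
  { initial   = λ n k → trans (ℤ.*-identityˡ _) (trans (initial _ _) (𝟙₀-even k))
  ; vanishing = λ r t n k 2+r≤t → trans (cong (sign t ℤ.*_) (vanishing r t _ _ 2+r≤t)) (ℤ.*-zeroʳ (sign t))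
  ; boundary  = λ r k → cong (-1ℤ ℤ.*_) (boundary r _)
  ; step-n    = dual-step-n
  ; step-k    = dual-step-k
  }
  where
  open Solution solution
  open ≡-Reasoning
  𝟙₀-even : ∀ k → 𝟙₀ (- k ℤ.- + 0) ≡ 𝟙₀ k
  𝟙₀-even (+ zero)    = refl
  𝟙₀-even (+ (suc k)) = refl
  𝟙₀-even -[1+ k ]    = refl
  dual-step-n : ∀ r t n k →
    dual A r t (1ℤ ℤ.+ n) k ≡ dual A r t n k ℤ.+ dual A r (suc t) (1ℤ ℤ.+ n) k
  dual-step-n r t n k = begin
    s ℤ.* A r t n′ k′
      ≡⟨ rearrange s (A r t n′ k′) (A r (suc t) (1ℤ ℤ.+ n′) k′) ⟩
    s ℤ.* (A r t n′ k′ ℤ.+ A r (suc t) (1ℤ ℤ.+ n′) k′) ℤ.+ - s ℤ.* A r (suc t) (1ℤ ℤ.+ n′) k′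
      ≡⟨ cong (λ i → s ℤ.* i ℤ.+ - s ℤ.* A r (suc t) (1ℤ ℤ.+ n′) k′) (step-n r t n′ k′) ⟨
    s ℤ.* A r t (1ℤ ℤ.+ n′) k′ ℤ.+ - s ℤ.* A r (suc t) (1ℤ ℤ.+ n′) k′
      ≡⟨ cong₂ (λ i j → s ℤ.* A r t i k′ ℤ.+ - s ℤ.* A r (suc t) j k′) (n₁ (+ t) n) (n₂ (+ t) n) ⟩
    dual A r t n k ℤ.+ dual A r (suc t) (1ℤ ℤ.+ n) k ∎
    where
    s  = sign t
    n′ = + t ℤ.- + 2 ℤ.- (1ℤ ℤ.+ n)
    k′ = - k ℤ.- + triangular r
    rearrange : ∀ s a b → s ℤ.* a ≡ s ℤ.* (a ℤ.+ b) ℤ.+ - s ℤ.* b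
    rearrange = solve-∀
    n₁ : ∀ t n → 1ℤ ℤ.+ (t ℤ.- + 2 ℤ.- (1ℤ ℤ.+ n)) ≡ t ℤ.- + 2 ℤ.- n
    n₁ = solve-∀
    n₂ : ∀ t n → 1ℤ ℤ.+ (t ℤ.- + 2 ℤ.- (1ℤ ℤ.+ n)) ≡ 1ℤ ℤ.+ t ℤ.- + 2 ℤ.- (1ℤ ℤ.+ n)
    n₂ = solve-∀
  dual-step-k : ∀ r t n k → dual A (suc r) (suc t) n k ≡
    dual A r t n k ℤ.+ dual A (suc r) (suc t) (1ℤ ℤ.+ n) (k ℤ.- + suc r)
  dual-step-k r t n k = begin
    - s ℤ.* A (suc r) (suc t) (+ suc t ℤ.- + 2 ℤ.- n) (- k ℤ.- + triangular (suc r))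
      ≡⟨ cong₂ (λ i j → - s ℤ.* A (suc r) (suc t) i j) (n₁ (+ t) n) k₁ ⟩
    - s ℤ.* A (suc r) (suc t) (1ℤ ℤ.+ n′) (k′ ℤ.- + suc r)
      ≡⟨ rearrange s (A r t n′ k′) (A (suc r) (suc t) (1ℤ ℤ.+ n′) (k′ ℤ.- + suc r)) ⟩
    s ℤ.* A r t n′ k′ ℤ.+ - s ℤ.* (A r t n′ k′ ℤ.+ A (suc r) (suc t) (1ℤ ℤ.+ n′) (k′ ℤ.- + suc r))
      ≡⟨ cong (λ i → s ℤ.* A r t n′ k′ ℤ.+ - s ℤ.* i) (step-k r t n′ k′) ⟨
    s ℤ.* A r t n′ k′ ℤ.+ - s ℤ.* A (suc r) (suc t) n′ k′
      ≡⟨ cong₂ (λ i j → s ℤ.* A r t n′ k′ ℤ.+ - s ℤ.* A (suc r) (suc t) i j) (n₂ (+ t) n) k₂ ⟩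
    dual A r t n k ℤ.+ dual A (suc r) (suc t) (1ℤ ℤ.+ n) (k ℤ.- + suc r) ∎
    where
    s  = sign t
    n′ = + t ℤ.- + 2 ℤ.- n
    k′ = - k ℤ.- + triangular r
    rearrange : ∀ s a b → - s ℤ.* b ≡ s ℤ.* a ℤ.+ - s ℤ.* (a ℤ.+ b)
    rearrange = solve-∀
    n₁ : ∀ t n → 1ℤ ℤ.+ t ℤ.- + 2 ℤ.- n ≡ 1ℤ ℤ.+ (t ℤ.- + 2 ℤ.- n)
    n₁ = solve-∀
    n₂ : ∀ t n → t ℤ.- + 2 ℤ.- n ≡ 1ℤ ℤ.+ t ℤ.- + 2 ℤ.- (1ℤ ℤ.+ n)
    n₂ = solve-∀
    assoc : ∀ k x y → - k ℤ.- (x ℤ.+ y) ≡ - k ℤ.- x ℤ.- y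
    assoc = solve-∀
    assoc′ : ∀ k x y → - k ℤ.- x ≡ - (k ℤ.- y) ℤ.- (x ℤ.+ y)
    assoc′ = solve-∀
    k₁ : - k ℤ.- + triangular (suc r) ≡ k′ ℤ.- + suc r
    k₁ = assoc k (+ triangular r) (+ suc r)
    k₂ : k′ ≡ - (k ℤ.- + suc r) ℤ.- + triangular (suc r)
    k₂ = assoc′ k (+ triangular r) (+ suc r)

-- Construction of the counting solution

-- For negative n this is the continuation that remains an antidifference of φ.
signedSum : (ℤ → ℤ) → ℤ → ℤ
signedSum φ (+ zero)       = φ 0ℤ
signedSum φ (+ (suc n))    = signedSum φ (+ n) ℤ.+ φ (+ suc n)
signedSum φ -[1+ zero ]    = 0ℤ
signedSum φ -[1+ (suc n) ] = signedSum φ -[1+ n ] ℤ.- φ -[1+ n ]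

signedSum-suc : ∀ φ n → signedSum φ (1ℤ ℤ.+ n) ≡ signedSum φ n ℤ.+ φ (1ℤ ℤ.+ n)
signedSum-suc φ (+ n)          = refl
signedSum-suc φ -[1+ zero ]    = sym (ℤ.+-identityˡ (φ 0ℤ))
signedSum-suc φ -[1+ (suc n) ] = cancel _ _
  where
  cancel : ∀ a b → a ≡ a ℤ.- b ℤ.+ b
  cancel = solve-∀

signedSum-0 : ∀ {φ} → (∀ i → φ i ≡ 0ℤ) → ∀ n → signedSum φ n ≡ 0ℤ
signedSum-0 φ≡0 (+ zero)       = φ≡0 0ℤ
signedSum-0 φ≡0 (+ (suc n))    = cong₂ ℤ._+_ (signedSum-0 φ≡0 (+ n)) (φ≡0 (+ suc n))
signedSum-0 φ≡0 -[1+ zero ]    = refl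
signedSum-0 φ≡0 -[1+ (suc n) ] = cong₂ ℤ._-_ (signedSum-0 φ≡0 -[1+ n ]) (φ≡0 -[1+ n ])

-- f only bounds the number of terms: ∑_{i≥0} φ(n+i, k-iw) is finite when φ vanishes at
-- negative k.
diagonalSum : ℕ → (ℤ → ℤ → ℤ) → ℕ → ℤ → ℤ → ℤ
diagonalSum w φ zero    n k = 0ℤ
diagonalSum w φ (suc f) n k = φ n k ℤ.+ diagonalSum w φ f (1ℤ ℤ.+ n) (k ℤ.- + w)

diagonalSum-0 : ∀ w {φ} → (∀ n k → φ n k ≡ 0ℤ) → ∀ f n k → diagonalSum w φ f n k ≡ 0ℤ
diagonalSum-0 w φ≡0 zero    n k = refl
diagonalSum-0 w φ≡0 (suc f) n k = cong₂ ℤ._+_ (φ≡0 n k) (diagonalSum-0 w φ≡0 f _ _)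

diagonalSum-step : ∀ w {φ ψ} → (∀ n k → φ (1ℤ ℤ.+ n) k ≡ φ n k ℤ.+ ψ (1ℤ ℤ.+ n) k) → ∀ f n k →
  diagonalSum w φ f (1ℤ ℤ.+ n) k ≡ diagonalSum w φ f n k ℤ.+ diagonalSum w ψ f (1ℤ ℤ.+ n) k
diagonalSum-step w step zero    n k = refl
diagonalSum-step w {φ} {ψ} step (suc f) n k = trans
  (cong₂ ℤ._+_ (step n k) (diagonalSum-step w {ψ = ψ} step f (1ℤ ℤ.+ n) (k ℤ.- + w)))
  (interchange (φ n k) (ψ (1ℤ ℤ.+ n) k) (diagonalSum w φ f (1ℤ ℤ.+ n) (k ℤ.- + w))
    (diagonalSum w ψ f (1ℤ ℤ.+ (1ℤ ℤ.+ n)) (k ℤ.- + w)))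
  where
  interchange : ∀ a b c d → a ℤ.+ b ℤ.+ (c ℤ.+ d) ≡ a ℤ.+ c ℤ.+ (b ℤ.+ d)
  interchange = solve-∀

-- Each term of the diagonal lowers k by at least one, so k + 1 terms exhaust the nonnegative
-- values.
fuel : ℤ → ℕ
fuel (+ k)    = suc k
fuel -[1+ _ ] = 0

<fuel : ∀ k → k ℤ.< + fuel k
<fuel (+ k)    = ℤ.+<+ (ℕ.n<1+n k)
<fuel -[1+ k ] = ℤ.-<+

k-1-w<f : ∀ r {k f} → k ℤ.< + suc f → k ℤ.- + suc r ℤ.< + f
k-1-w<f r {k} {f} k< = ℤ.<-≤-trans
  (subst (k ℤ.- + suc r ℤ.<_) (ℤ.+-identityʳ k) (ℤ.+-monoʳ-< k (ℤ.-<+ {r} {0})))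
  (ℤ.i<j⇒i≤pred[j] k<)

module _ (r : ℕ) {φ : ℤ → ℤ → ℤ} (φ-support : ∀ n k → k ℤ.< 0ℤ → φ n k ≡ 0ℤ) where

  diagonalSum-support : ∀ f n k → k ℤ.< 0ℤ → diagonalSum (suc r) φ f n k ≡ 0ℤ
  diagonalSum-support zero    n k k<0 = refl
  diagonalSum-support (suc f) n k k<0 = cong₂ ℤ._+_ (φ-support n k k<0)
    (diagonalSum-support f _ _ (k-1-w<f r (ℤ.<-trans k<0 (ℤ.+<+ ℕ.z<s))))

  -- Unfolding the sum at k leaves k terms for the tail, whereas `counts⁺` at k - (r + 1) computes
  -- its own fuel; `step-k` has to identify the two.
  diagonalSum-fuel : ∀ f g n k → k ℤ.< + f → k ℤ.< + g →
    diagonalSum (suc r) φ f n k ≡ diagonalSum (suc r) φ g n k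
  diagonalSum-fuel zero    g       n k k<f k<g = sym (diagonalSum-support g n k k<f)
  diagonalSum-fuel (suc f) zero    n k k<f k<g = diagonalSum-support (suc f) n k k<g
  diagonalSum-fuel (suc f) (suc g) n k k<f k<g =
    cong (λ i → φ n k ℤ.+ i) (diagonalSum-fuel f g _ _ (k-1-w<f r k<f) (k-1-w<f r k<g))

integrate : (ℕ → ℤ → ℤ → ℤ) → ℕ → ℤ → ℤ → ℤ
integrate φ zero    n k = signedSum (λ i → φ 0 i k) n
integrate φ (suc t)     = φ t

-- counts⁺ r t is the A r (t+1) of the header, which keeps the recursion structural.
counts⁺ : Family
counts⁺ zero    zero    n k = 𝟙₀ k
counts⁺ zero    (suc t) n k = 0ℤ
counts⁺ (suc r) t       n k = diagonalSum (suc r) (integrate (counts⁺ r) t) (fuel k) n k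

counts : Family
counts r = integrate (counts⁺ r)

counts⁺-support : ∀ r t n k → counts⁺ r t n -[1+ k ] ≡ 0ℤ
counts⁺-support zero    zero    n k = refl
counts⁺-support zero    (suc t) n k = refl
counts⁺-support (suc r) t       n k = refl

counts-support : ∀ r t n k → k ℤ.< 0ℤ → counts r t n k ≡ 0ℤ
counts-support r t       n (+ k)    (ℤ.+<+ ())
counts-support r zero    n -[1+ k ] _ = signedSum-0 (λ i → counts⁺-support r 0 i k) n
counts-support r (suc t) n -[1+ k ] _ = counts⁺-support r t n k

-- `step-k` splits off the first term of the diagonal. For length r + 1 and positive t, `step-n` is
-- the recurrence for length r summed along the diagonal, since a shift of n carries diagonals to
-- diagonals; at t = 0 it is the defining property of the antidifference.
counts-solution : Solution counts
counts-solution = record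
  { initial   = λ n k → refl
  ; vanishing = vanishing
  ; boundary  = λ r k → refl
  ; step-n    = step-n
  ; step-k    = step-k
  }
  where
  vanishing : ∀ r t n k → 2 + r ℕ.≤ t → counts r t n k ≡ 0ℤ
  vanishing zero    (suc (suc t)) n k _               = refl
  vanishing (suc r) (suc t)       n k (ℕ.s≤s 2+r≤t) =
    diagonalSum-0 (suc r) (λ n k → vanishing r t n k 2+r≤t) (fuel k) n k
  vanishing zero (suc zero) n k (ℕ.s≤s ())
  step-n : ∀ r t n k → counts r t (1ℤ ℤ.+ n) k ≡ counts r t n k ℤ.+ counts r (suc t) (1ℤ ℤ.+ n) k
  step-n r       zero          n k = signedSum-suc (λ i → counts r 1 i k) n
  step-n zero    (suc zero)    n k = sym (ℤ.+-identityʳ (𝟙₀ k))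
  step-n zero    (suc (suc t)) n k = refl
  step-n (suc r) (suc t)       n k = diagonalSum-step (suc r) (step-n r t) (fuel k) n k
  step-k : ∀ r t n k → counts (suc r) (suc t) n k ≡
    counts r t n k ℤ.+ counts (suc r) (suc t) (1ℤ ℤ.+ n) (k ℤ.- + suc r)
  step-k r t n (+ k)    = cong (λ i → counts r t n (+ k) ℤ.+ i)
    (diagonalSum-fuel r (counts-support r t) k (fuel (+ k ℤ.- + suc r)) _ _
      (k-1-w<f r (ℤ.+<+ (ℕ.n<1+n k))) (<fuel (+ k ℤ.- + suc r)))
  step-k r t n -[1+ k ] = sym (trans (ℤ.+-identityʳ _) (counts-support r t n -[1+ k ] ℤ.-<+))

-- Enumeration of the sequences c and d

-- Only sums over these enumerations matter, so agreement up to order is enough, and that can be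
-- checked on members without regard to the bounds used in `tuples`.
unique-↭ : {A : Set} {xs ys : List A} → Unique xs → Unique ys →
  (∀ {x} → x ∈ xs → x ∈ ys) → (∀ {x} → x ∈ ys → x ∈ xs) → xs ↭ ys
unique-↭ xs! ys! to from = ∼bag⇒↭ (unique∧set⇒bag xs! ys! (mk⇔ to from))

sum-map-+ : {A : Set} (f g : A → ℕ) (xs : List A) →
  sum (map (λ x → f x + g x) xs) ≡ sum (map f xs) + sum (map g xs)
sum-map-+ f g []       = refl
sum-map-+ f g (x ∷ xs) = trans (cong (λ s → f x + g x + s) (sum-map-+ f g xs))
  (interchange (f x) (g x) (sum (map f xs)) (sum (map g xs)))
  where
  interchange : ∀ a b c d → a + b + (c + d) ≡ a + c + (b + d)
  interchange = ℕ-Solver.solve-∀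

entries≤sum : ∀ {r} (c : Vec ℕ r) → Allⱽ (ℕ._≤ Vec.sum c) c
entries≤sum []      = []
entries≤sum (x ∷ c) = ℕ.m≤m+n x _ ∷ Allⱽ.map (ℕ.m≤n⇒m≤o+n x) (entries≤sum c)

tuples-unique : ∀ r b → Unique (tuples r b)
tuples-unique zero    b = All.[] ∷ []
tuples-unique (suc r) b =
  Unique.cartesianProductWith⁺ _∷_ Vec.∷-injective (Unique.upTo⁺ (suc b)) (tuples-unique r b)

∈-tuples : ∀ {r b} {c : Vec ℕ r} → Allⱽ (ℕ._≤ b) c → c ∈ tuples r b
∈-tuples []           = here refl
∈-tuples (x≤b ∷ c≤b) = ∈.∈-cartesianProductWith⁺ _∷_ (∈.∈-upTo⁺ (ℕ.s≤s x≤b)) (∈-tuples c≤b)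

HasSum : ∀ {r} → ℕ → Vec ℕ r → Set
HasSum k c = Vec.sum c ≡ k × Ascending c

hasSum? : ∀ {r} k → Decidable (HasSum {r} k)
hasSum? k c = (Vec.sum c ℕ.≟ k) ×-dec ascending? c

∈-ascendingWithSum⁺ : ∀ {r k} {c : Vec ℕ r} → HasSum k c → c ∈ ascendingWithSum r k
∈-ascendingWithSum⁺ {c = c} p@(refl , _) = ∈.∈-filter⁺ (hasSum? _) (∈-tuples (entries≤sum c)) p

∈-ascendingWithSum⁻ : ∀ {r k} {c : Vec ℕ r} → c ∈ ascendingWithSum r k → HasSum k c
∈-ascendingWithSum⁻ {r} {k} c∈ = proj₂ (∈.∈-filter⁻ (hasSum? k) {xs = tuples r k} c∈)

ascendingWithSum-unique : ∀ r k → Unique (ascendingWithSum r k)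
ascendingWithSum-unique r k = Unique.filter⁺ (hasSum? k) (tuples-unique r k)

ascending-0∷ : ∀ {r} {c : Vec ℕ r} → Ascending c → Ascending (0 ∷ c)
ascending-0∷ {c = []}    _   = [-]
ascending-0∷ {c = _ ∷ _} asc = ℕ.z≤n ∷ asc

ascending-suc : ∀ {r} {c : Vec ℕ r} → Ascending c → Ascending (Vec.map suc c)
ascending-suc = Linked.map⁺ ∘ Linked.map ℕ.s≤s

ascending-suc⁻ : ∀ {r} {c : Vec ℕ r} → Ascending (Vec.map suc c) → Ascending c
ascending-suc⁻ = Linked.map ℕ.s≤s⁻¹ ∘ Linked.map⁻

sum-suc : ∀ {r} (c : Vec ℕ r) → Vec.sum (Vec.map suc c) ≡ r + Vec.sum c
sum-suc []          = refl
sum-suc {suc r} (x ∷ c) = cong suc (trans (cong (λ s → x + s) (sum-suc c)) (swap x r (Vec.sum c)))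
  where
  swap : ∀ x r s → x + (r + s) ≡ r + (x + s)
  swap = ℕ-Solver.solve-∀

positive-map-suc : ∀ {r x} {c : Vec ℕ r} → Ascending (suc x ∷ c) → ∃[ d ] suc x ∷ c ≡ Vec.map suc d
positive-map-suc {x = x} [-] = x ∷ [] , refl
positive-map-suc {x = x} {c = suc y ∷ c} (_ ∷ asc) with positive-map-suc asc
... | d , eq = x ∷ d , cong (suc x ∷_) eq

splitFirst : ∀ {r k} {c : Vec ℕ (suc r)} → HasSum k c →
  (∃[ d ] c ≡ 0 ∷ d × HasSum k d) ⊎ (∃[ d ] c ≡ Vec.map suc d × suc r + Vec.sum d ≡ k × Ascending d)
splitFirst {c = zero  ∷ c} (sum≡k , asc) = inj₁ (c , refl , sum≡k , Linked.tail asc)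
splitFirst {c = suc x ∷ c} (sum≡k , asc) with positive-map-suc asc
... | d , eq = inj₂ (d , eq , trans (sym (trans (cong Vec.sum eq) (sum-suc d))) sum≡k ,
                     ascending-suc⁻ (subst Ascending eq asc))

map-suc-injective : ∀ {r} {c d : Vec ℕ r} → Vec.map ℕ.suc c ≡ Vec.map ℕ.suc d → c ≡ d
map-suc-injective {c = []}    {[]}    _  = refl
map-suc-injective {c = x ∷ c} {y ∷ d} eq =
  cong₂ _∷_ (ℕ.suc-injective (Vec.∷-injectiveˡ eq)) (map-suc-injective (Vec.∷-injectiveʳ eq))

0∷-unique : ∀ r k → Unique (map (0 ∷_) (ascendingWithSum r k))
0∷-unique r k = Unique.map⁺ Vec.∷-injectiveʳ (ascendingWithSum-unique r k)

∈-0∷ : ∀ {r k} {c : Vec ℕ (suc r)} → c ∈ map (0 ∷_) (ascendingWithSum r k) → c ∈ ascendingWithSum (suc r) k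
∈-0∷ c∈ with ∈.∈-map⁻ (0 ∷_) c∈
... | d , d∈ , refl with ∈-ascendingWithSum⁻ d∈
... | sum≡k , asc = ∈-ascendingWithSum⁺ (sum≡k , ascending-0∷ asc)

ascendingWithSum-< : ∀ r k → k ℕ.< suc r →
  ascendingWithSum (suc r) k ↭ map (0 ∷_) (ascendingWithSum r k)
ascendingWithSum-< r k k<1+r = unique-↭ (ascendingWithSum-unique (suc r) k) (0∷-unique r k) to ∈-0∷
  where
  to : ∀ {c} → c ∈ ascendingWithSum (suc r) k → c ∈ map (0 ∷_) (ascendingWithSum r k)
  to c∈ with splitFirst (∈-ascendingWithSum⁻ c∈)
  ... | inj₁ (d , refl , p)     = ∈.∈-map⁺ (0 ∷_) (∈-ascendingWithSum⁺ p)
  ... | inj₂ (d , _ , refl , _) = contradiction k<1+r (ℕ.≤⇒≯ (ℕ.m≤m+n (suc r) (Vec.sum d)))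

ascendingWithSum-≥ : ∀ r k → ascendingWithSum (suc r) (suc r + k) ↭
  map (0 ∷_) (ascendingWithSum r (suc r + k)) ++ map (Vec.map suc) (ascendingWithSum (suc r) k)
ascendingWithSum-≥ r k = unique-↭ (ascendingWithSum-unique (suc r) _)
  (Unique.++⁺ (0∷-unique r _)
    (Unique.map⁺ map-suc-injective (ascendingWithSum-unique (suc r) k)) disjoint)
  to (λ c∈ → [ ∈-0∷ , from ]′ (∈.∈-++⁻ _ c∈))
  where
  disjoint : ∀ {c} → ¬ (c ∈ map (0 ∷_) (ascendingWithSum r (suc r + k)) ×
                        c ∈ map (Vec.map suc) (ascendingWithSum (suc r) k))
  disjoint (c∈₀ , c∈₁) with ∈.∈-map⁻ (0 ∷_) c∈₀ | ∈.∈-map⁻ (Vec.map suc) c∈₁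
  ... | _ , _ , refl | _ ∷ _ , _ , ()
  to : ∀ {c} → c ∈ ascendingWithSum (suc r) (suc r + k) →
    c ∈ map (0 ∷_) (ascendingWithSum r (suc r + k)) ++ map (Vec.map suc) (ascendingWithSum (suc r) k)
  to c∈ with splitFirst (∈-ascendingWithSum⁻ c∈)
  ... | inj₁ (d , refl , p)         = ∈.∈-++⁺ˡ (∈.∈-map⁺ (0 ∷_) (∈-ascendingWithSum⁺ p))
  ... | inj₂ (d , refl , eq , asc) = ∈.∈-++⁺ʳ _ (∈.∈-map⁺ (Vec.map suc)
    (∈-ascendingWithSum⁺ (ℕ.+-cancelˡ-≡ (suc r) _ _ eq , asc)))
  from : ∀ {c} → c ∈ map (Vec.map suc) (ascendingWithSum (suc r) k) → c ∈ ascendingWithSum (suc r) (suc r + k)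
  from c∈ with ∈.∈-map⁻ (Vec.map suc) c∈
  ... | d , d∈ , refl with ∈-ascendingWithSum⁻ d∈
  ... | refl , asc = ∈-ascendingWithSum⁺ (sum-suc d , ascending-suc asc)

-- Recurrences for the nested sums

interval-suc : ∀ a b → [ 1ℤ ℤ.+ a ⋯ 1ℤ ℤ.+ b ] ≡ map (λ d → 1ℤ ℤ.+ d) [ a ⋯ b ]
interval-suc a b = begin
  map (λ i → 1ℤ ℤ.+ a ℤ.+ + i) (upTo ∣ 1ℤ ℤ.+ b ℤ.- (1ℤ ℤ.+ a) ∣⁺)
    ≡⟨ cong (λ j → map (λ i → 1ℤ ℤ.+ a ℤ.+ + i) (upTo ∣ j ∣⁺)) (difference a b) ⟩
  map (λ i → 1ℤ ℤ.+ a ℤ.+ + i) (upTo ∣ b ℤ.- a ∣⁺)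
    ≡⟨ List.map-cong (λ i → ℤ.+-assoc 1ℤ a (+ i)) _ ⟩
  map (λ i → 1ℤ ℤ.+ (a ℤ.+ + i)) (upTo ∣ b ℤ.- a ∣⁺)
    ≡⟨ List.map-∘ _ ⟩
  map (λ d → 1ℤ ℤ.+ d) [ a ⋯ b ] ∎
  where
  open ≡-Reasoning
  ∣_∣⁺ : ℤ → ℕ
  ∣ i ∣⁺ = ℤ.∣ 0ℤ ℤ.⊔ (i ℤ.+ 1ℤ) ∣
  difference : ∀ a b → 1ℤ ℤ.+ b ℤ.- (1ℤ ℤ.+ a) ≡ b ℤ.- a
  difference = solve-∀

nested-suc : ∀ {r} a (c : Vec ℕ r) → nested (1ℤ ℤ.+ a) (Vec.map suc c) ≡ nested a c
nested-suc a []      = refl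
nested-suc a (x ∷ c) = cong sum (begin
  map (λ d → nested d (Vec.map suc c)) [ 1ℤ ℤ.+ a ⋯ + suc x ]
    ≡⟨ cong (map (λ d → nested d (Vec.map suc c))) (interval-suc a (+ x)) ⟩
  map (λ d → nested d (Vec.map suc c)) (map (λ d → 1ℤ ℤ.+ d) [ a ⋯ + x ])
    ≡⟨ List.map-∘ _ ⟨
  map (λ d → nested (1ℤ ℤ.+ d) (Vec.map suc c)) [ a ⋯ + x ]
    ≡⟨ List.map-cong (λ d → nested-suc d c) _ ⟩
  map (λ d → nested d c) [ a ⋯ + x ] ∎)
  where open ≡-Reasoning

nestedTotal : (r n k : ℕ) → ℕ
nestedTotal r n k = sum (map (nested (- (+ n))) (ascendingWithSum r k))

-- When c₁ = 0, the entry d₁ runs from -n to 0, which is the range of d₀ in α_r(k,n).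
sum-0∷ : ∀ r n k → sum (map (nested (- (+ n))) (map (0 ∷_) (ascendingWithSum r k))) ≡ α₂ r k n
sum-0∷ r n k = cong sum (sym (List.map-∘ (ascendingWithSum r k)))

nestedTotal-< : ∀ r n k → k ℕ.< suc r → nestedTotal (suc r) n k ≡ α₂ r k n
nestedTotal-< r n k k<1+r =
  trans (sum-↭ (↭.map⁺ (nested (- (+ n))) (ascendingWithSum-< r k k<1+r))) (sum-0∷ r n k)

nestedTotal-≥ : ∀ r n k →
  nestedTotal (suc r) n (suc r + k) ≡ α₂ r (suc r + k) n + nestedTotal (suc r) (suc n) k
nestedTotal-≥ r n k = begin
  nestedTotal (suc r) n (suc r + k)
    ≡⟨ sum-↭ (↭.map⁺ f (ascendingWithSum-≥ r k)) ⟩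
  sum (map f (map (0 ∷_) cs₀ ++ map (Vec.map suc) cs₁))
    ≡⟨ cong sum (List.map-++ f (map (0 ∷_) cs₀) _) ⟩
  sum (map f (map (0 ∷_) cs₀) ++ map f (map (Vec.map suc) cs₁))
    ≡⟨ sum-++ (map f (map (0 ∷_) cs₀)) _ ⟩
  sum (map f (map (0 ∷_) cs₀)) + sum (map f (map (Vec.map suc) cs₁))
    ≡⟨ cong₂ _+_ (sum-0∷ r n (suc r + k))
         (cong sum (trans (sym (List.map-∘ cs₁)) (List.map-cong shift cs₁))) ⟩
  α₂ r (suc r + k) n + nestedTotal (suc r) (suc n) k ∎
  where
  open ≡-Reasoning
  cs₀ = ascendingWithSum r (suc r + k)
  cs₁ = ascendingWithSum (suc r) k
  f : Vec ℕ (suc r) → ℕ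
  f = nested (- (+ n))
  -n≡1-[1+n] : ∀ n → - n ≡ 1ℤ ℤ.+ - (1ℤ ℤ.+ n)
  -n≡1-[1+n] = solve-∀
  shift : ∀ c → f (Vec.map suc c) ≡ nested (- (+ suc n)) c
  shift c = trans (cong (λ a → nested a (Vec.map suc c)) (-n≡1-[1+n] (+ n))) (nested-suc (- (+ suc n)) c)

interval-⁻0 : ∀ j → [ - (+ j) ⋯ 0ℤ ] ≡ map (λ i → - (+ j) ℤ.+ + i) (upTo (suc j))
interval-⁻0 j = cong (λ m → map (λ i → - (+ j) ℤ.+ + i) (upTo ℤ.∣ 0ℤ ℤ.⊔ m ∣)) (length-⁻0 (+ j))
  where
  length-⁻0 : ∀ j → 0ℤ ℤ.- (- j) ℤ.+ 1ℤ ≡ 1ℤ ℤ.+ j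
  length-⁻0 = solve-∀

interval-suc-0 : ∀ j → [ - (+ suc j) ⋯ 0ℤ ] ≡ - (+ suc j) ∷ [ - (+ j) ⋯ 0ℤ ]
interval-suc-0 j = begin
  [ - (+ suc j) ⋯ 0ℤ ]
    ≡⟨ interval-⁻0 (suc j) ⟩
  map (λ i → - (+ suc j) ℤ.+ + i) (upTo (suc (suc j)))
    ≡⟨ cong (λ is → - (+ suc j) ∷ map (λ i → - (+ suc j) ℤ.+ + i) is) (List.map-upTo suc (suc j)) ⟨
  - (+ suc j) ∷ map (λ i → - (+ suc j) ℤ.+ + i) (map suc (upTo (suc j)))
    ≡⟨ cong (- (+ suc j) ∷_) (trans (sym (List.map-∘ (upTo (suc j))))
         (List.map-cong (λ i → shift (+ j) (+ i)) (upTo (suc j)))) ⟩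
  - (+ suc j) ∷ map (λ i → - (+ j) ℤ.+ + i) (upTo (suc j))
    ≡⟨ cong (- (+ suc j) ∷_) (interval-⁻0 j) ⟨
  - (+ suc j) ∷ [ - (+ j) ⋯ 0ℤ ] ∎
  where
  open ≡-Reasoning
  shift : ∀ j i → - (1ℤ ℤ.+ j) ℤ.+ (1ℤ ℤ.+ i) ≡ - j ℤ.+ i
  shift = solve-∀

α₂-zero : ∀ r k → α₂ r k 0 ≡ nestedTotal r 0 k
α₂-zero r k = cong sum (List.map-cong (λ c → ℕ.+-identityʳ (nested 0ℤ c)) (ascendingWithSum r k))

α₂-suc : ∀ r k j → α₂ r k (suc j) ≡ α₂ r k j + nestedTotal r (suc j) k
α₂-suc r k j = begin
  α₂ r k (suc j)
    ≡⟨ cong sum (List.map-cong (λ c → cong (λ ds → sum (map (λ d → nested d c) ds)) (interval-suc-0 j))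
         (ascendingWithSum r k)) ⟩
  sum (map (λ c → nested (- (+ suc j)) c + sum (map (λ d → nested d c) [ - (+ j) ⋯ 0ℤ ]))
           (ascendingWithSum r k))
    ≡⟨ sum-map-+ (nested (- (+ suc j))) _ (ascendingWithSum r k) ⟩
  nestedTotal r (suc j) k + α₂ r k j
    ≡⟨ ℕ.+-comm (nestedTotal r (suc j) k) _ ⟩
  α₂ r k j + nestedTotal r (suc j) k ∎
  where open ≡-Reasoning

-- From counted pairs to nested sums

length-filter-map : {B C : Set} {P : Pred C 0ℓ} {R : Pred B 0ℓ} (P? : Decidable P) (R? : Decidable R)
  (f : B → C) → (∀ y → P (f y) → R y) → (∀ y → R y → P (f y)) → ∀ ys →
  length (filter P? (map f ys)) ≡ length (filter R? ys)
length-filter-map P? R? f to from []       = refl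
length-filter-map P? R? f to from (y ∷ ys) with P? (f y) | R? y
... | yes _ | yes _ = cong suc (length-filter-map P? R? f to from ys)
... | no  _ | no  _ = length-filter-map P? R? f to from ys
... | yes p | no ¬r = contradiction (to y p) ¬r
... | no ¬p | yes r = contradiction (from y r) ¬p

-- Counting fibre by fibre serves twice: it separates c from d in `α₁`, and the first entry of d
-- from the others in `count-below`.
length-filter-cartesianProductWith : {A B C : Set} {P : Pred C 0ℓ} {Q : Pred A 0ℓ} {R : A → Pred B 0ℓ}
  (P? : Decidable P) (Q? : Decidable Q) (R? : ∀ x → Decidable (R x)) (f : A → B → C) →
  (∀ x y → P (f x y) → Q x × R x y) → (∀ x y → Q x → R x y → P (f x y)) → ∀ xs ys →
  length (filter P? (cartesianProductWith f xs ys)) ≡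
  sum (map (λ x → length (filter (R? x) ys)) (filter Q? xs))
length-filter-cartesianProductWith P? Q? R? f to from []       ys = refl
length-filter-cartesianProductWith P? Q? R? f to from (x ∷ xs) ys = begin
  length (filter P? (map (f x) ys ++ rest))
    ≡⟨ cong length (List.filter-++ P? (map (f x) ys) rest) ⟩
  length (filter P? (map (f x) ys) ++ filter P? rest)
    ≡⟨ List.length-++ (filter P? (map (f x) ys)) ⟩
  length (filter P? (map (f x) ys)) + length (filter P? rest)
    ≡⟨ cong (λ s → length (filter P? (map (f x) ys)) + s)
         (length-filter-cartesianProductWith P? Q? R? f to from xs ys) ⟩
  length (filter P? (map (f x) ys)) + sum (map g (filter Q? xs))
    ≡⟨ first ⟩
  sum (map g (filter Q? (x ∷ xs))) ∎
  where
  open ≡-Reasoning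
  g = λ x → length (filter (R? x) ys)
  rest = cartesianProductWith f xs ys
  first : length (filter P? (map (f x) ys)) + sum (map g (filter Q? xs)) ≡ sum (map g (filter Q? (x ∷ xs)))
  first with Q? x
  ... | yes q = cong (_+ _) (length-filter-map P? (R? x) (f x) (λ y → proj₂ ∘ to x y) (λ y → from x y q) ys)
  -- The whole block over x fails `P`, so it is compared with a filter that rejects everything.
  ... | no ¬q = cong (_+ _) (trans
    (length-filter-map P? (λ _ → no λ x → x) (f x) (λ y → ¬q ∘ proj₁ ∘ to x y) (λ _ ()) ys)
    (cong length (none ys)))
    where
    none : ∀ zs → filter (λ _ → no λ x → x) zs ≡ []
    none []       = refl
    none (z ∷ zs) = none zs

∣0⊔m⊖n∣≡m∸n : ∀ m n → ℤ.∣ 0ℤ ℤ.⊔ (m ℤ.⊖ n) ∣ ≡ m ∸ n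
∣0⊔m⊖n∣≡m∸n m n with ℕ.≤-total n m
... | inj₁ n≤m = cong (λ i → ℤ.∣ 0ℤ ℤ.⊔ i ∣) (ℤ.⊖-≥ n≤m)
... | inj₂ m≤n = trans (cong (λ i → ℤ.∣ 0ℤ ℤ.⊔ i ∣) (ℤ.⊖-≤ m≤n))
  (trans (cong ℤ.∣_∣ (ℤ.i≥j⇒i⊔j≡i (ℤ.neg-≤-pos {n ∸ m} {0}))) (sym (ℕ.m≤n⇒m∸n≡0 m≤n)))

interval-ℕ : ∀ m n → [ + m ⋯ + n ] ≡ map (λ i → + (m + i)) (upTo (suc n ∸ m))
interval-ℕ m n = cong (λ l → map (λ i → + (m + i)) (upTo l))
  (trans (cong (λ i → ℤ.∣ 0ℤ ℤ.⊔ i ∣) (trans (rearrange (+ m) (+ n)) (ℤ.m-n≡m⊖n (suc n) m)))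
    (∣0⊔m⊖n∣≡m∸n (suc n) m))
  where
  rearrange : ∀ m n → n ℤ.- m ℤ.+ 1ℤ ≡ 1ℤ ℤ.+ n ℤ.- m
  rearrange = solve-∀

between? : ∀ m n → Decidable (λ x → m ℕ.≤ x × x ℕ.≤ n)
between? m n x = (m ℕ.≤? x) ×-dec (x ℕ.≤? n)

-- `α₁` draws entries of d from naturals up to a cut-off, while `nested` runs over integers. From a
-- natural lower bound on, the two ranges agree as soon as the cut-off reaches n.
filter-between : ∀ {b} m n → n ℕ.≤ b →
  map (λ x → + x) (filter (between? m n) (upTo (suc b))) ↭ [ + m ⋯ + n ]
filter-between {b} m n n≤b rewrite interval-ℕ m n =
  unique-↭ (Unique.map⁺ ℤ.+-injective (Unique.filter⁺ (between? m n) (Unique.upTo⁺ (suc b))))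
    (Unique.map⁺ (ℕ.+-cancelˡ-≡ m _ _ ∘ ℤ.+-injective) (Unique.upTo⁺ (suc n ∸ m))) to from
  where
  filtered shifted : List ℤ
  filtered = map (λ x → + x) (filter (between? m n) (upTo (suc b)))
  shifted  = map (λ i → + (m + i)) (upTo (suc n ∸ m))
  to : ∀ {v} → v ∈ filtered → v ∈ shifted
  to v∈ with ∈.∈-map⁻ (λ x → + x) v∈
  ... | x , x∈ , refl with ∈.∈-filter⁻ (between? m n) x∈
  ... | _ , m≤x , x≤n = subst (_∈ shifted) (cong (λ x → + x) (ℕ.m+[n∸m]≡n m≤x))
    (∈.∈-map⁺ (λ i → + (m + i)) (∈.∈-upTo⁺ (ℕ.∸-monoˡ-< (ℕ.s≤s x≤n) m≤x)))
  from : ∀ {v} → v ∈ shifted → v ∈ filtered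
  from v∈ with ∈.∈-map⁻ (λ i → + (m + i)) v∈
  ... | i , i∈ , refl = ∈.∈-map⁺ (λ x → + x) (∈.∈-filter⁺ (between? m n)
      (∈.∈-upTo⁺ (ℕ.s≤s (ℕ.≤-trans m+i≤n n≤b))) (ℕ.m≤m+n m i , m+i≤n))
    where
    m+i≤n : m + i ℕ.≤ n
    m+i≤n = ℕ.s≤s⁻¹ (subst₂ ℕ._≤_ (ℕ.+-suc m i) (ℕ.m+[n∸m]≡n m≤1+n) (ℕ.+-monoʳ-≤ m (∈.∈-upTo⁻ i∈)))
      where
      m≤1+n : m ℕ.≤ suc n
      m≤1+n = ℕ.<⇒≤ (ℕ.m∸n≢0⇒n<m {suc n} {m} (ℕ.m<n⇒n≢0 (∈.∈-upTo⁻ i∈)))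

-- Prepending n records the lower bound inherited from the previous entry of d, in the role of the
-- first argument of `nested`; it imposes nothing on an empty d.
Below : ∀ {r} → ℕ → Vec ℕ r → Vec ℕ r → Set
Below n c d = Ascending (n ∷ d) × Pointwise ℕ._≤_ d c

below? : ∀ {r} n (c : Vec ℕ r) → Decidable (Below n c)
below? n c d = ascending? (n ∷ d) ×-dec Pointwise.decidable ℕ._≤?_ d c

count-below : ∀ {r b} n {c : Vec ℕ r} → Allⱽ (ℕ._≤ b) c →
  length (filter (below? n c) (tuples r b)) ≡ nested (+ n) c
count-below n []                      = refl
count-below {suc r} {b} n {x ∷ c} (x≤b ∷ c≤b) = begin
  length (filter (below? n (x ∷ c)) (tuples (suc r) b))
    ≡⟨ length-filter-cartesianProductWith (below? n (x ∷ c)) (between? n x) (λ y → below? y c) _∷_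
         (λ where y d (n≤y ∷ asc , y≤x ∷ d≤c) → (n≤y , y≤x) , asc , d≤c)
         (λ where y d (n≤y , y≤x) (asc , d≤c) → n≤y ∷ asc , y≤x ∷ d≤c)
         (upTo (suc b)) (tuples r b) ⟩
  sum (map (λ y → length (filter (below? y c) (tuples r b))) ys)
    ≡⟨ cong sum (List.map-cong (λ y → count-below y c≤b) ys) ⟩
  sum (map (λ y → nested (+ y) c) ys)
    ≡⟨ cong sum (List.map-∘ ys) ⟩
  sum (map (λ d → nested d c) (map (λ x → + x) ys))
    ≡⟨ sum-↭ (↭.map⁺ (λ d → nested d c) (filter-between n x x≤b)) ⟩
  nested (+ n) (x ∷ c) ∎
  where
  open ≡-Reasoning
  ys = filter (between? n x) (upTo (suc b))

α₁≡nestedTotal : ∀ r k → α₁ r k ≡ nestedTotal r 0 k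
α₁≡nestedTotal r k = begin
  α₁ r k
    ≡⟨ length-filter-cartesianProductWith (isPair? k) (hasSum? k) (below? 0) _,_
         (λ where c d (asc , asc′ , sum≡k , d≤c) → (sum≡k , asc) , ascending-0∷ asc′ , d≤c)
         (λ where c d (sum≡k , asc) (asc′ , d≤c) → asc , Linked.tail asc′ , sum≡k , d≤c)
         (tuples r k) (tuples r k) ⟩
  sum (map (λ c → length (filter (below? 0 c) (tuples r k))) (ascendingWithSum r k))
    ≡⟨ cong sum (List.map-cong-local (All.tabulate λ c∈ →
         count-below 0 (entries≤k (∈-ascendingWithSum⁻ c∈)))) ⟩
  nestedTotal r 0 k ∎
  where
  open ≡-Reasoning
  entries≤k : ∀ {c : Vec ℕ r} → HasSum k c → Allⱽ (ℕ._≤ k) c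
  entries≤k {c} (refl , _) = entries≤sum c

-- The two generating functions

nestedTotal-0 : ∀ n k → counts 0 1 (+ n) (+ k) ≡ + nestedTotal 0 n k
nestedTotal-0 n zero    = refl
nestedTotal-0 n (suc k) = refl

-- The cases t = 0 and t = 1 feed each other: `step-n` reduces t = 0 to t = 1 at the same length,
-- and `step-k` reduces t = 1 at length r + 1 to t = 0 at length r. Taking the first case as a
-- hypothesis lets the induction on r below call this lemma.
counts₀≡α₂ : ∀ r → (∀ n k → counts r 1 (+ n) (+ k) ≡ + nestedTotal r n k) →
  ∀ j k → counts r 0 (+ j) (+ k) ≡ + α₂ r k j
counts₀≡α₂ r counts₁ zero    k = trans (counts₁ 0 k) (cong (λ m → + m) (sym (α₂-zero r k)))
counts₀≡α₂ r counts₁ (suc j) k = trans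
  (cong₂ ℤ._+_ (counts₀≡α₂ r counts₁ j k) (counts₁ (suc j) k)) (cong (λ m → + m) (sym (α₂-suc r k j)))

counts₁≡nestedTotal : ∀ r n k → counts r 1 (+ n) (+ k) ≡ + nestedTotal r n k
counts₁≡nestedTotal zero    n k = nestedTotal-0 n k
counts₁≡nestedTotal (suc r) n k = bounded (suc k) n k (ℕ.n<1+n k)
  where
  open ≡-Reasoning
  counts₀ = counts₀≡α₂ r (counts₁≡nestedTotal r)
  unfold : ∀ n k → counts (suc r) 1 (+ n) (+ k) ≡
    + α₂ r k n ℤ.+ counts (suc r) 1 (+ suc n) (+ k ℤ.- + suc r)
  unfold n k = trans (Solution.step-k counts-solution r 0 (+ n) (+ k))
    (cong (λ i → i ℤ.+ counts (suc r) 1 (+ suc n) (+ k ℤ.- + suc r)) (counts₀ n k))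
  cancel : ∀ i j → i ℤ.+ j ℤ.- i ≡ j
  cancel = solve-∀
  -- Removing r + 1 from k raises n by one, so n varies in the induction; N bounds k because k falls
  -- by r + 1 at a time.
  bounded : ∀ N n k → k ℕ.< N → counts (suc r) 1 (+ n) (+ k) ≡ + nestedTotal (suc r) n k
  bounded (suc N) n k k<1+N with k ℕ.<? suc r
  ... | yes k<1+r = begin
    counts (suc r) 1 (+ n) (+ k)
      ≡⟨ unfold n k ⟩
    + α₂ r k n ℤ.+ counts (suc r) 1 (+ suc n) (+ k ℤ.- + suc r)
      ≡⟨ cong (λ i → + α₂ r k n ℤ.+ i) (counts-support (suc r) 1 (+ suc n) _
           (subst (+ k ℤ.- + suc r ℤ.<_) (ℤ.+-inverseʳ (+ suc r))
             (ℤ.+-monoˡ-< (- (+ suc r)) (ℤ.+<+ k<1+r)))) ⟩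
    + α₂ r k n ℤ.+ 0ℤ
      ≡⟨ ℤ.+-identityʳ _ ⟩
    + α₂ r k n
      ≡⟨ cong (λ m → + m) (nestedTotal-< r n k k<1+r) ⟨
    + nestedTotal (suc r) n k ∎
  ... | no k≮1+r with ℕ.m≤n⇒∃[o]m+o≡n (ℕ.≮⇒≥ k≮1+r)
  ... | k′ , refl = begin
    counts (suc r) 1 (+ n) (+ (suc r + k′))
      ≡⟨ unfold n (suc r + k′) ⟩
    + α₂ r (suc r + k′) n ℤ.+ counts (suc r) 1 (+ suc n) (+ (suc r + k′) ℤ.- + suc r)
      ≡⟨ cong (λ i → + α₂ r (suc r + k′) n ℤ.+ counts (suc r) 1 (+ suc n) i) (cancel (+ suc r) (+ k′)) ⟩
    + α₂ r (suc r + k′) n ℤ.+ counts (suc r) 1 (+ suc n) (+ k′)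
      ≡⟨ cong (λ i → + α₂ r (suc r + k′) n ℤ.+ i) (bounded N (suc n) k′
           (ℕ.≤-trans (ℕ.s≤s (ℕ.m≤n+m k′ r)) (ℕ.s≤s⁻¹ k<1+N))) ⟩
    + (α₂ r (suc r + k′) n + nestedTotal (suc r) (suc n) k′)
      ≡⟨ cong (λ m → + m) (nestedTotal-≥ r n k′) ⟨
    + nestedTotal (suc r) n (suc r + k′) ∎

coeff-F₁ : ∀ r k → coeffˢ (F₁ r) (k ∷ []) ≡ counts r 1 0ℤ k
coeff-F₁ r (+ k)    = trans (cong (λ m → + m) (α₁≡nestedTotal r k)) (sym (counts₁≡nestedTotal r 0 k))
coeff-F₁ r -[1+ k ] = sym (counts-support r 1 0ℤ -[1+ k ] ℤ.-<+)

coeff-F₂ : ∀ r k j → coeffˢ (F₂ r) (k ∷ + j ∷ []) ≡ counts r 0 (+ j) k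
coeff-F₂ r (+ k)    j = sym (counts₀≡α₂ r (counts₁≡nestedTotal r) j k)
coeff-F₂ r -[1+ k ] j = sym (counts-support r 0 (+ j) -[1+ k ] ℤ.-<+)

coeff-F₂-neg : ∀ r k j → j ℤ.< 0ℤ → coeffˢ (F₂ r) (k ∷ j ∷ []) ≡ 0ℤ
coeff-F₂-neg r k j = coeffˢ-below (F₂ r) (k ∷ j ∷ []) (suc zero)

triangular*2 : ∀ r → r * (r + 1) ≡ triangular r * 2
triangular*2 zero    = refl
triangular*2 (suc r) = trans (expand r)
  (trans (cong (_+ suc r * 2) (triangular*2 r)) (sym (ℕ.*-distribʳ-+ 2 (triangular r) (suc r))))
  where
  expand : ∀ r → suc r * (suc r + 1) ≡ r * (r + 1) + suc r * 2
  expand = ℕ-Solver.solve-∀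

r[r+1]/2 : ∀ r → r * (r + 1) / 2 ≡ triangular r
r[r+1]/2 r = trans (cong (_/ 2) (triangular*2 r)) (m*n/n≡m (triangular r) 2)

r[r+3]/2 : ∀ r → r * (r + 3) / 2 ≡ triangular r + r
r[r+3]/2 r = trans
  (cong (_/ 2) (trans (expand r) (trans (cong (_+ r * 2) (triangular*2 r)) (sym (ℕ.*-distribʳ-+ 2 (triangular r) r)))))
  (m*n/n≡m (triangular r + r) 2)
  where
  expand : ∀ r → r * (r + 3) ≡ r * (r + 1) + r * 2
  expand = ℕ-Solver.solve-∀

counts-annihilator : ∀ r →
  ∃[ ws ] All (0 ℕ.<_) ws × (∀ t → (ws Annihilates counts - dual counts) r t)
counts-annihilator = annihilator counts-solution (dual-solution counts-solution)

module Univariate (r : ℕ) where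

  ws : List ℕ
  ws = proj₁ (counts-annihilator r)

  steps : List (Vec ℕ 1)
  steps = map (_∷ []) ws

  steps≢0 : All Nonzero steps
  steps≢0 = All.map⁺ (All.map (λ 0<w → zero , 0<w)
    (proj₁ (proj₂ (counts-annihilator r))))

  shift : Exponent 1
  shift = + (r * (r + 3) / 2) ∷ []

  Δ*-∇* : ∀ ws (φ : Exponent 1 → ℤ) k → Δ* (map (_∷ []) ws) φ (k ∷ []) ≡ ∇* ws (λ k → φ (k ∷ [])) k
  Δ*-∇* []       φ k = refl
  Δ*-∇* (w ∷ ws) φ k = cong₂ ℤ._-_ (Δ*-∇* ws φ k) (Δ*-∇* ws φ (k ℤ.- + w))

  -- At n = -1 the term of smaller length in `step-k` is the `boundary` zero, so only a shift
  -- survives. The dual pairs n = 0 with n = -1 at t = 1, and this shift by r brings the latter back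
  -- to the series.
  counts-lower : ∀ r k → counts r 1 -1ℤ k ≡ counts r 1 0ℤ (k ℤ.- + r)
  counts-lower zero    k = cong 𝟙₀ (sym (ℤ.+-identityʳ k))
  counts-lower (suc r) k = trans (Solution.step-k counts-solution r 0 -1ℤ k)
    (ℤ.+-identityˡ (counts (suc r) 1 0ℤ (k ℤ.- + suc r)))

  reflect-F₁ : ∀ k → reflect shift (coeffˢ (F₁ r)) (k ∷ []) ≡ dual counts r 1 0ℤ k
  reflect-F₁ k = begin
    coeffˢ (F₁ r) (- k ℤ.- + (r * (r + 3) / 2) ∷ [])
      ≡⟨ coeff-F₁ r _ ⟩
    counts r 1 0ℤ (- k ℤ.- + (r * (r + 3) / 2))
      ≡⟨ cong (λ m → counts r 1 0ℤ (- k ℤ.- + m)) (r[r+3]/2 r) ⟩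
    counts r 1 0ℤ (- k ℤ.- + (triangular r + r))
      ≡⟨ cong (counts r 1 0ℤ) (assoc k (+ triangular r) (+ r)) ⟩
    counts r 1 0ℤ (- k ℤ.- + triangular r ℤ.- + r)
      ≡⟨ counts-lower r _ ⟨
    counts r 1 -1ℤ (- k ℤ.- + triangular r)
      ≡⟨ ℤ.*-identityˡ _ ⟨
    dual counts r 1 0ℤ k ∎
    where
    open ≡-Reasoning
    assoc : ∀ k x y → - k ℤ.- (x ℤ.+ y) ≡ - k ℤ.- x ℤ.- y
    assoc = solve-∀

  reciprocal : Δ* steps (coeffˢ (F₁ r)) ≗ Δ* steps (reflect shift (coeffˢ (F₁ r)))
  reciprocal (k ∷ []) = begin
    Δ* steps (coeffˢ (F₁ r)) (k ∷ [])
      ≡⟨ Δ*-∇* ws _ k ⟩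
    ∇* ws (λ k → coeffˢ (F₁ r) (k ∷ [])) k
      ≡⟨ ∇*-cong ws (coeff-F₁ r) k ⟩
    ∇* ws (counts r 1 0ℤ) k
      ≡⟨ proj₂ (proj₂ (counts-annihilator r)) 1 0ℤ k ⟩
    ∇* ws (dual counts r 1 0ℤ) k
      ≡⟨ ∇*-cong ws reflect-F₁ k ⟨
    ∇* ws (λ k → reflect shift (coeffˢ (F₁ r)) (k ∷ [])) k
      ≡⟨ Δ*-∇* ws _ k ⟨
    Δ* steps (reflect shift (coeffˢ (F₁ r))) (k ∷ []) ∎
    where open ≡-Reasoning

module Bivariate (r : ℕ) where

  ws : List ℕ
  ws = proj₁ (counts-annihilator r)

  x^_ : ℕ → Vec ℕ 2
  x^ w = w ∷ 0 ∷ []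

  y : Vec ℕ 2
  y = 0 ∷ 1 ∷ []

  steps : ℕ → List (Vec ℕ 2)
  steps m = replicate m y ++ map x^_ ws

  steps≢0 : ∀ m → All Nonzero (steps m)
  steps≢0 m = All.++⁺ (All.replicate⁺ m (suc zero , ℕ.z<s)) (All.map⁺ (All.map (λ 0<w → zero , 0<w)
    (proj₁ (proj₂ (counts-annihilator r)))))

  shift : Exponent 2
  shift = + (r * (r + 1) / 2) ∷ + 2 ∷ []

  F H : Exponent 2 → ℤ
  F = coeffˢ (F₂ r)
  H = reflect shift F

  Δ*-∇* : ∀ ws (φ : Exponent 2 → ℤ) k j →
    Δ* (map x^_ ws) φ (k ∷ j ∷ []) ≡ ∇* ws (λ k → φ (k ∷ j ∷ [])) k
  Δ*-∇* []       φ k j = refl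
  Δ*-∇* (w ∷ ws) φ k j = cong₂ ℤ._-_ (Δ*-∇* ws φ k j) (trans
    (cong (λ i → Δ* (map x^_ ws) φ (k ℤ.- + w ∷ i ∷ [])) (ℤ.+-identityʳ j))
    (Δ*-∇* ws φ (k ℤ.- + w) j))

  H-nonneg : ∀ k j → H (k ∷ + j ∷ []) ≡ 0ℤ
  H-nonneg k j = coeff-F₂-neg r (- k ℤ.- + (r * (r + 1) / 2)) _
    (subst (ℤ._< 0ℤ) (ℤ.neg-distrib-+ (+ j) (+ 2)) (ℤ.neg-mono-< (ℤ.+<+ (ℕ.<-≤-trans ℕ.z<s (ℕ.m≤n+m 2 j)))))

  H-neg : ∀ k j → H (k ∷ -[1+ j ] ∷ []) ≡ - dual counts r 0 -[1+ j ] k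
  -- The exponent -1 is the fixed point of j ↦ -2 - j, and `counts r 0` vanishes there.
  H-neg k zero    = coeff-F₂-neg r (- k ℤ.- + (r * (r + 1) / 2)) -1ℤ ℤ.-<+
  H-neg k (suc j) = begin
    F (- k ℤ.- + (r * (r + 1) / 2) ∷ + j ∷ [])
      ≡⟨ coeff-F₂ r _ j ⟩
    counts r 0 (+ j) (- k ℤ.- + (r * (r + 1) / 2))
      ≡⟨ cong (λ m → counts r 0 (+ j) (- k ℤ.- + m)) (r[r+1]/2 r) ⟩
    counts r 0 (+ j) (- k ℤ.- + triangular r)
      ≡⟨ double-neg _ ⟩
    - dual counts r 0 -[1+ suc j ] k ∎
    where
    open ≡-Reasoning
    double-neg : ∀ i → i ≡ - (-1ℤ ℤ.* i)
    double-neg = solve-∀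

  -- F carries `counts r 0 j` for j ≥ 0 only. For j < 0 its place is taken by H, which equals minus
  -- the dual and hence, after the factors in x, minus `counts r 0 j`. So F and H differ by the full
  -- two-sided family.
  difference-x : ∀ k j →
    Δ* (map x^_ ws) F (k ∷ j ∷ []) ≡ Δ* (map x^_ ws) H (k ∷ j ∷ []) ℤ.+ ∇* ws (counts r 0 j) k
  difference-x k j = trans (Δ*-∇* ws F k j) (trans (in-x j)
    (cong (λ i → i ℤ.+ ∇* ws (counts r 0 j) k) (sym (Δ*-∇* ws H k j))))
    where
    open ≡-Reasoning
    in-x : ∀ j → ∇* ws (λ k → F (k ∷ j ∷ [])) k ≡
      ∇* ws (λ k → H (k ∷ j ∷ [])) k ℤ.+ ∇* ws (counts r 0 j) k
    in-x (+ j) = begin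
      ∇* ws (λ k → F (k ∷ + j ∷ [])) k
        ≡⟨ ∇*-cong ws (λ k → coeff-F₂ r k j) k ⟩
      ∇* ws (counts r 0 (+ j)) k
        ≡⟨ ℤ.+-identityˡ _ ⟨
      0ℤ ℤ.+ ∇* ws (counts r 0 (+ j)) k
        ≡⟨ cong (λ i → i ℤ.+ ∇* ws (counts r 0 (+ j)) k)
             (trans (∇*-cong ws (λ k → H-nonneg k j) k) (∇*-0 ws k)) ⟨
      ∇* ws (λ k → H (k ∷ + j ∷ [])) k ℤ.+ ∇* ws (counts r 0 (+ j)) k ∎
    in-x -[1+ j ] = begin
      ∇* ws (λ k → F (k ∷ -[1+ j ] ∷ [])) k
        ≡⟨ trans (∇*-cong ws (λ k → coeff-F₂-neg r k -[1+ j ] ℤ.-<+) k) (∇*-0 ws k) ⟩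
      0ℤ
        ≡⟨ ℤ.+-inverseˡ (∇* ws (dual counts r 0 -[1+ j ]) k) ⟨
      - ∇* ws (dual counts r 0 -[1+ j ]) k ℤ.+ ∇* ws (dual counts r 0 -[1+ j ]) k
        ≡⟨ cong₂ ℤ._+_ (trans (∇*-cong ws (λ k → H-neg k j) k) (∇*-neg ws (dual counts r 0 -[1+ j ]) k))
             (proj₂ (proj₂ (counts-annihilator r)) 0 -[1+ j ] k) ⟨
      ∇* ws (λ k → H (k ∷ -[1+ j ] ∷ [])) k ℤ.+ ∇* ws (counts r 0 -[1+ j ]) k ∎

  -- A factor 1 - y takes the difference in j, which by `step-n` replaces `counts r m` by
  -- `counts r (suc m)`. After r + 2 such factors the remainder lies in the vanishing range.
  difference : ∀ m k j →
    Δ* (steps m) F (k ∷ j ∷ []) ≡ Δ* (steps m) H (k ∷ j ∷ []) ℤ.+ ∇* ws (counts r m j) k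
  difference zero    k j = difference-x k j
  difference (suc m) k j = begin
    Δ* (steps m) F (k ∷ j ∷ []) ℤ.- Δ* (steps m) F (k ℤ.+ 0ℤ ∷ j′ ∷ [])
      ≡⟨ cong₂ ℤ._-_ (difference m k j) (difference m (k ℤ.+ 0ℤ) j′) ⟩
    h ℤ.+ ∇* ws (counts r m j) k ℤ.- (h′ ℤ.+ ∇* ws (counts r m j′) (k ℤ.+ 0ℤ))
      ≡⟨ cong₂ (λ u v → h ℤ.+ u ℤ.- (h′ ℤ.+ v)) step (cong (∇* ws (counts r m j′)) (ℤ.+-identityʳ k)) ⟩
    h ℤ.+ (∇* ws (counts r m j′) k ℤ.+ ∇* ws (counts r (suc m) j) k) ℤ.- (h′ ℤ.+ ∇* ws (counts r m j′) k)
      ≡⟨ regroup h h′ (∇* ws (counts r m j′) k) (∇* ws (counts r (suc m) j) k) ⟩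
    h ℤ.- h′ ℤ.+ ∇* ws (counts r (suc m) j) k ∎
    where
    open ≡-Reasoning
    j′ = j ℤ.- 1ℤ
    h  = Δ* (steps m) H (k ∷ j ∷ [])
    h′ = Δ* (steps m) H (k ℤ.+ 0ℤ ∷ j′ ∷ [])
    regroup : ∀ h h′ a b → h ℤ.+ (a ℤ.+ b) ℤ.- (h′ ℤ.+ a) ≡ h ℤ.- h′ ℤ.+ b
    regroup = solve-∀
    1+j′≡j : ∀ j → 1ℤ ℤ.+ (j ℤ.- 1ℤ) ≡ j
    1+j′≡j = solve-∀
    step : ∇* ws (counts r m j) k ≡ ∇* ws (counts r m j′) k ℤ.+ ∇* ws (counts r (suc m) j) k
    step = subst (λ i → ∇* ws (counts r m i) k ≡ ∇* ws (counts r m j′) k ℤ.+ ∇* ws (counts r (suc m) i) k)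
      (1+j′≡j j) (∇*-step-n counts-solution ws r m j′ k)

  reciprocal : Δ* (steps (2 + r)) F ≗ Δ* (steps (2 + r)) H
  reciprocal (k ∷ j ∷ []) = trans (difference (2 + r) k j)
    (trans (cong (λ i → Δ* (steps (2 + r)) H (k ∷ j ∷ []) ℤ.+ i) (trans
      (∇*-cong ws (λ k → Solution.vanishing counts-solution r (2 + r) j k ℕ.≤-refl) k) (∇*-0 ws k)))
      (ℤ.+-identityʳ _))

proposition4 : (r : ℕ) →
    ( (∃[ f ] F₂ r IsExpansionOf f)
    × (∀ f → F₂ r IsExpansionOf f →
    f ≈ x^ (- (+ (r * (r + 1) / 2)) ∷ - (+ 2) ∷ []) * (f ⟨1/x⟩)) )
    ×
    ( (∃[ f ] F₁ r IsExpansionOf f)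
    × (∀ f → F₁ r IsExpansionOf f →
    f ≈ x^ (- (+ (r * (r + 3) / 2)) ∷ []) * (f ⟨1/x⟩)) )
proposition4 r =
  ( expansion (F₂ r) B.shift (B.steps (2 + r)) (B.steps≢0 (2 + r)) B.reciprocal
  , functionalEquation (F₂ r) B.shift (B.steps (2 + r)) (B.steps≢0 (2 + r)) B.reciprocal ) ,
  ( expansion (F₁ r) U.shift U.steps U.steps≢0 U.reciprocal
  , functionalEquation (F₁ r) U.shift U.steps U.steps≢0 U.reciprocal )
  where
  module U = Univariate r
  module B = Bivariate r
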